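{- For any $k\ge 2$ there exists a graph in $k_{\mathrm{DIR}}\text{ -CONV}$ which is not a SEG graph.
   Context: All graphs are finite. A polygon is a closed convex polygon in $\mathbb{R}^2$. For a finite collection of sets, its intersection graph has one vertex for each member of the collection, and two distinct vertices are adjacent iff the corresponding sets have nonempty intersection. SEG is the class of intersection graphs of finite collections of straight-line segments in the plane. For a set $L$ of $k$ distinct lines through the origin in $\mathbb{R}^2$, $\mathcal{P}(L)$ is the family of all polygons each of whose sides is parallel to some line of $L$; $k_{\mathrm{DIR}(L)}\text{ -CONV}$ is the class of intersection graphs of finite collections of polygons from $\mathcal{P}(L)$, and $k_{\mathrm{DIR}}\text{ -CONV}$ is the union of $k_{\mathrm{DIR}(L)}\text{ -CONV}$ over all sets $L$ of $k$ distinct lines through the origin. -}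

module Defs where

open import Level using (0ℓ)
open import Data.Nat as ℕ using (ℕ; suc)
import Data.Nat.Properties as ℕP
open import Data.Nat.DivMod using (_mod_)
open import Data.Fin using (Fin; toℕ)
open import Data.Rational as ℚ using (ℚ; 0ℚ; 1ℚ; ½)
import Data.Rational.Properties as ℚP
open import Data.Rational.Solver using (module +-*-Solver)
open import Data.Product using (∃; ∃-syntax; Σ-syntax; _×_; _,_; proj₁; proj₂)
open import Data.Vec.Functional using (Vector; foldr)
open import Function using (_⇔_)
open import Relation.Nullary using (¬_)
open import Relation.Unary using (Pred; _≐_; _≬_; _∈_)
open import Relation.Binary using (Rel; Decidable; Symmetric)
open import Relation.Binary.PropositionalEquality using (_≡_; _≢_; refl; sym; trans; cong; subst)

infix  4 _≈_ _<_ _≤_ _≈ᵖ_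
infixl 6 _+_ _-_ _+ᵖ_ _-ᵖ_
infixl 7 _*_ _*ᵖ_
infix  8 -_

------------------------------------------------------------------------
-- Real numbers, as Cauchy sequences of rationals. Equality is the
-- equivalence relation _≈_, not _≡_.

Eventually : Pred ℕ 0ℓ → Set
Eventually P = ∃[ N ] (∀ n → N ℕ.≤ n → P n)

Cauchy : (ℕ → ℚ) → Set
Cauchy x = ∀ ε → 0ℚ ℚ.< ε →
  ∃[ N ] (∀ m n → N ℕ.≤ m → N ℕ.≤ n → ℚ.∣ x m ℚ.- x n ∣ ℚ.< ε)

record ℝ : Set where
  constructor mkℝ
  field
    seq    : ℕ → ℚ
    cauchy : Cauchy seq

open ℝ public

_≈_ : Rel ℝ 0ℓ
x ≈ y = ∀ ε → 0ℚ ℚ.< ε → Eventually λ n → ℚ.∣ seq x n ℚ.- seq y n ∣ ℚ.< ε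

_<_ : Rel ℝ 0ℓ
x < y = ∃[ ε ] (0ℚ ℚ.< ε × Eventually λ n → seq x n ℚ.+ ε ℚ.< seq y n)

_≤_ : Rel ℝ 0ℓ
x ≤ y = ¬ (y < x)

fromℚ : ℚ → ℝ
fromℚ q = mkℝ (λ _ → q) λ ε 0<ε →
  0 , λ _ _ _ _ → subst (ℚ._< ε) (sym (cong ℚ.∣_∣ (ℚP.+-inverseʳ q))) 0<ε

0ℝ 1ℝ : ℝ
0ℝ = fromℚ 0ℚ
1ℝ = fromℚ 1ℚ

private
  ⊔≤ : ∀ {a b i} → a ℕ.⊔ b ℕ.≤ i → a ℕ.≤ i × b ℕ.≤ i
  ⊔≤ {a} {b} h = ℕP.m⊔n≤o⇒m≤o a b h , ℕP.m⊔n≤o⇒n≤o a b h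

  Cauchy-+ : ∀ {x y} → Cauchy x → Cauchy y → Cauchy (λ n → x n ℚ.+ y n)
  Cauchy-+ {x} {y} cx cy ε 0<ε = N ℕ.⊔ M , close
    where
    0<ε/2 : 0ℚ ℚ.< ½ ℚ.* ε
    0<ε/2 = subst (ℚ._< ½ ℚ.* ε) (ℚP.*-zeroʳ ½) (ℚP.*-monoʳ-<-pos ½ 0<ε)

    N = proj₁ (cx _ 0<ε/2)
    M = proj₁ (cy _ 0<ε/2)

    regroup : ∀ a b c d → (a ℚ.+ b) ℚ.- (c ℚ.+ d) ≡ (a ℚ.- c) ℚ.+ (b ℚ.- d)
    regroup = solve 4 (λ a b c d → (a :+ b) :- (c :+ d) := (a :- c) :+ (b :- d)) refl
      where open +-*-Solver

    halves : ½ ℚ.* ε ℚ.+ ½ ℚ.* ε ≡ ε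
    halves = trans (sym (ℚP.*-distribʳ-+ ε ½ ½)) (ℚP.*-identityˡ ε)

    close : ∀ m n → N ℕ.⊔ M ℕ.≤ m → N ℕ.⊔ M ℕ.≤ n →
            ℚ.∣ (x m ℚ.+ y m) ℚ.- (x n ℚ.+ y n) ∣ ℚ.< ε
    close m n m≥ n≥ = begin-strict
      ℚ.∣ (x m ℚ.+ y m) ℚ.- (x n ℚ.+ y n) ∣
        ≡⟨ cong ℚ.∣_∣ (regroup (x m) (y m) (x n) (y n)) ⟩
      ℚ.∣ (x m ℚ.- x n) ℚ.+ (y m ℚ.- y n) ∣
        ≤⟨ ℚP.∣p+q∣≤∣p∣+∣q∣ (x m ℚ.- x n) (y m ℚ.- y n) ⟩
      ℚ.∣ x m ℚ.- x n ∣ ℚ.+ ℚ.∣ y m ℚ.- y n ∣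
        <⟨ ℚP.+-mono-<
             (proj₂ (cx _ 0<ε/2) m n (ℕP.m⊔n≤o⇒m≤o N M m≥) (ℕP.m⊔n≤o⇒m≤o N M n≥))
             (proj₂ (cy _ 0<ε/2) m n (ℕP.m⊔n≤o⇒n≤o N M m≥) (ℕP.m⊔n≤o⇒n≤o N M n≥)) ⟩
      ½ ℚ.* ε ℚ.+ ½ ℚ.* ε
        ≡⟨ halves ⟩
      ε ∎
      where open ℚP.≤-Reasoning

  Cauchy-neg : ∀ {x} → Cauchy x → Cauchy (λ n → ℚ.- x n)
  Cauchy-neg {x} cx ε 0<ε = proj₁ (cx ε 0<ε) , λ m n m≥ n≥ →
    subst (ℚ._< ε) (sym (swap m n)) (proj₂ (cx ε 0<ε) n m n≥ m≥)
    where
    swap : ∀ m n → ℚ.∣ ℚ.- x m ℚ.- (ℚ.- x n) ∣ ≡ ℚ.∣ x n ℚ.- x m ∣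
    swap m n = cong ℚ.∣_∣ (solve 2 (λ a b → :- a :- (:- b) := b :- a) refl (x m) (x n))
      where open +-*-Solver

  Cauchy⇒bounded : ∀ {x} → Cauchy x →
    Σ[ B ∈ ℚ ] (0ℚ ℚ.< B × Eventually λ n → ℚ.∣ x n ∣ ℚ.≤ B)
  Cauchy⇒bounded {x} cx = 1ℚ ℚ.+ ℚ.∣ x N ∣ , 0<B , N , bound
    where
    0<1 : 0ℚ ℚ.< 1ℚ
    0<1 = ℚP.positive⁻¹ 1ℚ

    N = proj₁ (cx 1ℚ 0<1)

    0<B : 0ℚ ℚ.< 1ℚ ℚ.+ ℚ.∣ x N ∣
    0<B = ℚP.+-mono-<-≤ 0<1 (ℚP.0≤∣p∣ (x N))

    split : ∀ a b → a ≡ (a ℚ.- b) ℚ.+ b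
    split = solve 2 (λ a b → a := (a :- b) :+ b) refl
      where open +-*-Solver

    bound : ∀ n → N ℕ.≤ n → ℚ.∣ x n ∣ ℚ.≤ 1ℚ ℚ.+ ℚ.∣ x N ∣
    bound n n≥ = begin
      ℚ.∣ x n ∣                           ≡⟨ cong ℚ.∣_∣ (split (x n) (x N)) ⟩
      ℚ.∣ (x n ℚ.- x N) ℚ.+ x N ∣         ≤⟨ ℚP.∣p+q∣≤∣p∣+∣q∣ (x n ℚ.- x N) (x N) ⟩
      ℚ.∣ x n ℚ.- x N ∣ ℚ.+ ℚ.∣ x N ∣     ≤⟨ ℚP.+-monoˡ-≤ ℚ.∣ x N ∣
                                               (ℚP.<⇒≤ (proj₂ (cx 1ℚ 0<1) n N n≥ ℕP.≤-refl)) ⟩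
      1ℚ ℚ.+ ℚ.∣ x N ∣                    ∎
      where open ℚP.≤-Reasoning

  divide : ∀ C ε → 0ℚ ℚ.< C → 0ℚ ℚ.< ε → Σ[ δ ∈ ℚ ] (0ℚ ℚ.< δ × C ℚ.* δ ≡ ε)
  divide C ε 0<C 0<ε = C⁻¹ ℚ.* ε , 0<δ , Cδ≡ε
    where
    instance
      C-pos : ℚ.Positive C
      C-pos = ℚ.positive 0<C

      C-nonZero : ℚ.NonZero C
      C-nonZero = ℚP.pos⇒nonZero C

    C⁻¹ : ℚ
    C⁻¹ = ℚ.1/ C

    0<δ : 0ℚ ℚ.< C⁻¹ ℚ.* ε
    0<δ = ℚP.positive⁻¹ (C⁻¹ ℚ.* ε)
      {{ℚP.pos*pos⇒pos C⁻¹ {{ℚP.1/pos⇒pos C}} ε {{ℚ.positive 0<ε}}}}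

    Cδ≡ε : C ℚ.* (C⁻¹ ℚ.* ε) ≡ ε
    Cδ≡ε = trans (sym (ℚP.*-assoc C C⁻¹ ε))
          (trans (cong (ℚ._* ε) (ℚP.*-inverseʳ C)) (ℚP.*-identityˡ ε))

  ∣ab∣<Cδ : ∀ {C δ} a b → 0ℚ ℚ.< C → ℚ.∣ a ∣ ℚ.≤ C → ℚ.∣ b ∣ ℚ.< δ → ℚ.∣ a ℚ.* b ∣ ℚ.< C ℚ.* δ
  ∣ab∣<Cδ {C} {δ} a b 0<C ∣a∣≤C ∣b∣<δ = begin-strict
    ℚ.∣ a ℚ.* b ∣         ≡⟨ ℚP.∣p*q∣≡∣p∣*∣q∣ a b ⟩
    ℚ.∣ a ∣ ℚ.* ℚ.∣ b ∣   ≤⟨ ℚP.*-monoʳ-≤-nonNeg ℚ.∣ b ∣ {{ℚP.∣-∣-nonNeg b}} ∣a∣≤C ⟩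
    C ℚ.* ℚ.∣ b ∣         <⟨ ℚP.*-monoʳ-<-pos C {{ℚ.positive 0<C}} ∣b∣<δ ⟩
    C ℚ.* δ               ∎
    where open ℚP.≤-Reasoning

  ∣ab-cd∣<ε : ∀ {A B δ ε} a b c d → 0ℚ ℚ.< A → 0ℚ ℚ.< B → (A ℚ.+ B) ℚ.* δ ≡ ε →
              ℚ.∣ a ∣ ℚ.≤ A → ℚ.∣ d ∣ ℚ.≤ B → ℚ.∣ a ℚ.- c ∣ ℚ.< δ → ℚ.∣ b ℚ.- d ∣ ℚ.< δ →
              ℚ.∣ a ℚ.* b ℚ.- c ℚ.* d ∣ ℚ.< ε
  ∣ab-cd∣<ε {A} {B} {δ} {ε} a b c d 0<A 0<B total ∣a∣≤A ∣d∣≤B ∣a-c∣<δ ∣b-d∣<δ = begin-strict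
    ℚ.∣ a ℚ.* b ℚ.- c ℚ.* d ∣
      ≡⟨ cong ℚ.∣_∣ (regroup a b c d) ⟩
    ℚ.∣ a ℚ.* (b ℚ.- d) ℚ.+ d ℚ.* (a ℚ.- c) ∣
      ≤⟨ ℚP.∣p+q∣≤∣p∣+∣q∣ (a ℚ.* (b ℚ.- d)) (d ℚ.* (a ℚ.- c)) ⟩
    ℚ.∣ a ℚ.* (b ℚ.- d) ∣ ℚ.+ ℚ.∣ d ℚ.* (a ℚ.- c) ∣
      <⟨ ℚP.+-mono-< (∣ab∣<Cδ a (b ℚ.- d) 0<A ∣a∣≤A ∣b-d∣<δ)
                     (∣ab∣<Cδ d (a ℚ.- c) 0<B ∣d∣≤B ∣a-c∣<δ) ⟩
    A ℚ.* δ ℚ.+ B ℚ.* δ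
      ≡⟨ sym (ℚP.*-distribʳ-+ δ A B) ⟩
    (A ℚ.+ B) ℚ.* δ
      ≡⟨ total ⟩
    ε ∎
    where
    open ℚP.≤-Reasoning

    regroup : ∀ a b c d → a ℚ.* b ℚ.- c ℚ.* d ≡ a ℚ.* (b ℚ.- d) ℚ.+ d ℚ.* (a ℚ.- c)
    regroup = solve 4 (λ a b c d → a :* b :- c :* d := a :* (b :- d) :+ d :* (a :- c)) refl
      where open +-*-Solver

  Cauchy-* : ∀ {x y} → Cauchy x → Cauchy y → Cauchy (λ n → x n ℚ.* y n)
  Cauchy-* {x} {y} cx cy ε 0<ε =
    let A , 0<A , K , ∣x∣≤A = Cauchy⇒bounded cx
        B , 0<B , L , ∣y∣≤B = Cauchy⇒bounded cy
        δ , 0<δ , total     = divide (A ℚ.+ B) ε (ℚP.+-mono-< 0<A 0<B) 0<ε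
        N , ∣x-x∣<δ         = cx δ 0<δ
        M , ∣y-y∣<δ         = cy δ 0<δ
    in K ℕ.⊔ (L ℕ.⊔ (N ℕ.⊔ M)) , λ m n m≥ n≥ →
      let m≥K , m≥LNM = ⊔≤ {K} m≥
          n≥K , n≥LNM = ⊔≤ {K} n≥
          m≥L , m≥NM  = ⊔≤ {L} m≥LNM
          n≥L , n≥NM  = ⊔≤ {L} n≥LNM
          m≥N , m≥M   = ⊔≤ {N} m≥NM
          n≥N , n≥M   = ⊔≤ {N} n≥NM
      in ∣ab-cd∣<ε (x m) (y m) (x n) (y n) 0<A 0<B total (∣x∣≤A m m≥K) (∣y∣≤B n n≥L)
           (∣x-x∣<δ m n m≥N n≥N) (∣y-y∣<δ m n m≥M n≥M)

_+_ : ℝ → ℝ → ℝ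
x + y = mkℝ (λ n → seq x n ℚ.+ seq y n) (Cauchy-+ {seq x} {seq y} (cauchy x) (cauchy y))

_*_ : ℝ → ℝ → ℝ
x * y = mkℝ (λ n → seq x n ℚ.* seq y n) (Cauchy-* {seq x} {seq y} (cauchy x) (cauchy y))

-_ : ℝ → ℝ
- x = mkℝ (λ n → ℚ.- seq x n) (Cauchy-neg {seq x} (cauchy x))

_-_ : ℝ → ℝ → ℝ
x - y = x + (- y)

sum : ∀ {n} → Vector ℝ n → ℝ
sum = foldr _+_ 0ℝ

------------------------------------------------------------------------
-- The plane

Point : Set
Point = ℝ × ℝ

PointSet : Set₁
PointSet = Pred Point 0ℓ

_≈ᵖ_ : Rel Point 0ℓ
(x , y) ≈ᵖ (x′ , y′) = x ≈ x′ × y ≈ y′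

_+ᵖ_ : Point → Point → Point
(x , y) +ᵖ (x′ , y′) = x + x′ , y + y′

_-ᵖ_ : Point → Point → Point
(x , y) -ᵖ (x′ , y′) = x - x′ , y - y′

_*ᵖ_ : ℝ → Point → Point
t *ᵖ (x , y) = t * x , t * y

origin : Point
origin = 0ℝ , 0ℝ

-- Positive iff turning counterclockwise from the first vector to the second
-- takes an angle strictly between 0 and π.
det : Point → Point → ℝ
det (x , y) (x′ , y′) = x * y′ - y * x′

StrictlyLeftOf : (a b p : Point) → Set
StrictlyLeftOf a b p = 0ℝ < det (b -ᵖ a) (p -ᵖ a)

ConvexHull : ∀ {n} → Vector Point n → PointSet
ConvexHull {n} v p = Σ[ w ∈ Vector ℝ n ]
  ( (∀ i → 0ℝ ≤ w i)
  × sum w ≈ 1ℝ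
  × (sum (λ i → w i * proj₁ (v i)) , sum (λ i → w i * proj₂ (v i))) ≈ᵖ p )

record Segment : Set where
  field
    start end : Point
    proper    : ¬ (start ≈ᵖ end)

segment : Segment → PointSet
segment s p = ∃[ t ] (0ℝ ≤ t × t ≤ 1ℝ × (start +ᵖ t *ᵖ (end -ᵖ start)) ≈ᵖ p)
  where open Segment s

record LineThroughOrigin : Set where
  field
    direction : Point
    nonzero   : ¬ (direction ≈ᵖ origin)

line : LineThroughOrigin → PointSet
line ℓ p = ∃[ t ] (t *ᵖ LineThroughOrigin.direction ℓ) ≈ᵖ p

-- A nondegenerate convex polygon, given by its corners listed
-- counterclockwise: relative to each side, all the corners not on that
-- side lie strictly to its left.
record Polygon : Set where
  field
    extra : ℕ

  corners : ℕ
  corners = 3 ℕ.+ extra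

  next : Fin corners → Fin corners
  next i = suc (toℕ i) mod corners

  field
    vertex : Vector Point corners
    convex : ∀ i j → j ≢ i → j ≢ next i →
             StrictlyLeftOf (vertex i) (vertex (next i)) (vertex j)

  side : Fin corners → Point
  side i = vertex (next i) -ᵖ vertex i

polygon : Polygon → PointSet
polygon P = ConvexHull (Polygon.vertex P)

-- A side is parallel to a line through the origin iff its direction vector
-- lies on that line.
_∥_ : Point → LineThroughOrigin → Set
v ∥ ℓ = v ∈ line ℓ

record Directions (k : ℕ) : Set where
  field
    lines    : Fin k → LineThroughOrigin
    distinct : ∀ i j → i ≢ j → ¬ (line (lines i) ≐ line (lines j))

𝒫 : ∀ {k} → Directions k → Pred Polygon 0ℓ
𝒫 L P = ∀ i → ∃[ j ] Polygon.side P i ∥ Directions.lines L j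

------------------------------------------------------------------------
-- Graphs

record Graph : Set₁ where
  field
    order       : ℕ
    Adj         : Rel (Fin order) 0ℓ
    adj?        : Decidable Adj
    symmetric   : Symmetric Adj
    irreflexive : ∀ i → ¬ Adj i i

open Graph

-- F is a finite collection, possibly with repeated members, each giving a
-- vertex of its own. The labelling of F by the vertices of G is the isomorphism between G and
-- the intersection graph of F.
IsIntersectionGraphOf : (G : Graph) → (Fin (order G) → PointSet) → Set
IsIntersectionGraphOf G F = ∀ i j → i ≢ j → Adj G i j ⇔ F i ≬ F j

SEG : Pred Graph 0ℓ
SEG G = Σ[ s ∈ (Fin (order G) → Segment) ] IsIntersectionGraphOf G (λ i → segment (s i))

DIR⟨_⟩-CONV : ∀ {k} → Directions k → Pred Graph 0ℓ
DIR⟨ L ⟩-CONV G = Σ[ P ∈ (Fin (order G) → Polygon) ]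
  ((∀ i → P i ∈ 𝒫 L) × IsIntersectionGraphOf G (λ i → polygon (P i)))

_DIR-CONV : ℕ → Pred Graph 0ℓ
(k DIR-CONV) G = Σ[ L ∈ Directions k ] DIR⟨ L ⟩-CONV G

{-# OPTIONS --safe #-}
module Submission where

-- The graph is the intersection graph of a square U and of an N × N grid in it:
-- N rows, N columns and a small square, a "cell", in each of the N² places where
-- a row crosses a column.  Suppose that it is represented by segments.  All of
-- them stab the segment U, which orders them.  If i and k meet on one side of U,
-- then the triangle that they form with U traps every j between them that is
-- disjoint from both.  Hence two links on the same side of U do not interleave,
-- and among the cells that are linked to their row and to their column on given
-- sides of U, the rows follow each other along U without a pattern a b a b, and
-- so do the columns.  Such a sequence changes its row less than 2N times, and
-- its column likewise.  Consecutive cells differ in one of the two, so that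
-- the four choices of sides leave room for at most 16N cells: N = 17 is too many.
-- The statement being negative, all case distinctions on reals are made under a
-- double negation.

open import Defs
open import Data.Nat using (ℕ; _≥_)
open import Data.Product using (∃-syntax; _×_)
open import Relation.Nullary using (¬_)

open import Level using (0ℓ)
open import Data.Empty using (⊥; ⊥-elim)
open import Data.Fin using (Fin; zero; suc; toℕ; combine; remQuot)
open import Data.Fin.Induction using (spo-wellFounded)
open import Data.Fin.Patterns using (0F; 1F; 2F; 3F)
import Data.Fin.Properties as FinP
open import Data.Integer as ℤ using (+_)
import Data.Integer.Properties as ℤP
open import Data.Nat as ℕ using (suc; z≤n; s≤s)
open import Data.Nat.DivMod using (_mod_)
import Data.Nat.Properties as ℕP
open import Data.Product using (∃; Σ-syntax; _,_; proj₁; proj₂; uncurry)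
open import Data.Rational as ℚ using (ℚ; 0ℚ; 1ℚ; ½)
open import Data.Rational.Literals using (fromℤ)
import Data.Rational.Properties as ℚP
open import Data.Rational.Solver using (module +-*-Solver)
open import Data.Sum using (_⊎_; inj₁; inj₂)
open import Data.Vec.Functional using (Vector)
open import Effect.Monad using (RawMonad)
open import Function using (mk⇔; Equivalence)
open import Induction.WellFounded using (Acc; acc)
open import Relation.Binary using (Rel; IsStrictTotalOrder; Tri; tri<; tri≈; tri>)
open import Relation.Binary.PropositionalEquality
  using (_≡_; _≢_; refl; sym; trans; cong; cong₂; subst; subst₂; isEquivalence)
open import Relation.Nullary using (Dec; yes; no)
open import Relation.Nullary.Decidable using (_×-dec_; _⊎-dec_; ¬?; ¬¬-excluded-middle)
open import Relation.Nullary.Negation using (¬¬-Monad)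
open import Relation.Unary using (Pred; Decidable; _∈_; _≬_)
open +-*-Solver using (solve; _:+_; _:*_; _:-_; :-_; _:=_; con)

-- Real numbers

eventually-× : ∀ {P Q} → Eventually P → Eventually Q → Eventually λ n → P n × Q n
eventually-× (N , p) (M , q) = N ℕ.⊔ M , λ n n≥ →
  p n (ℕP.m⊔n≤o⇒m≤o N M n≥) , q n (ℕP.m⊔n≤o⇒n≤o N M n≥)

eventually-map : ∀ {P Q} → (∀ n → P n → Q n) → Eventually P → Eventually Q
eventually-map f (N , p) = N , λ n n≥ → f n (p n n≥)

eventually⇒∃ : ∀ {P} → Eventually P → ∃ P
eventually⇒∃ (N , p) = N , p N ℕP.≤-refl

0<*ℚ : ∀ {p q} → 0ℚ ℚ.< p → 0ℚ ℚ.< q → 0ℚ ℚ.< p ℚ.* q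
0<*ℚ {p} {q} 0<p 0<q =
  ℚP.positive⁻¹ (p ℚ.* q) {{ℚP.pos*pos⇒pos p {{ℚ.positive 0<p}} q {{ℚ.positive 0<q}}}}

0<½* : ∀ {ε} → 0ℚ ℚ.< ε → 0ℚ ℚ.< ½ ℚ.* ε
0<½* = 0<*ℚ (ℚP.positive⁻¹ ½)

halves : ∀ ε → ½ ℚ.* ε ℚ.+ ½ ℚ.* ε ≡ ε
halves ε = trans (sym (ℚP.*-distribʳ-+ ε ½ ½)) (ℚP.*-identityˡ ε)

inverseℚ : ∀ q → 0ℚ ℚ.< q → Σ[ r ∈ ℚ ] (0ℚ ℚ.< r × q ℚ.* r ≡ 1ℚ)
inverseℚ q 0<q = 1/q , ℚP.positive⁻¹ 1/q {{ℚP.1/pos⇒pos q {{ℚ.positive 0<q}}}} , ℚP.*-inverseʳ q {{≢0}}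
  where
  ≢0 : ℚ.NonZero q
  ≢0 = ℚP.pos⇒nonZero q {{ℚ.positive 0<q}}
  1/q = ℚ.1/_ q {{≢0}}

∣-∣-comm : ∀ p q → ℚ.∣ p ℚ.- q ∣ ≡ ℚ.∣ q ℚ.- p ∣
∣-∣-comm p q = trans
  (cong ℚ.∣_∣ (solve 2 (λ p q → p :- q := :- (q :- p)) refl p q)) (ℚP.∣-p∣≡∣p∣ (q ℚ.- p))

∣-∣-triangle : ∀ p q r → ℚ.∣ p ℚ.- r ∣ ℚ.≤ ℚ.∣ p ℚ.- q ∣ ℚ.+ ℚ.∣ q ℚ.- r ∣
∣-∣-triangle p q r = subst (λ s → ℚ.∣ s ∣ ℚ.≤ ℚ.∣ p ℚ.- q ∣ ℚ.+ ℚ.∣ q ℚ.- r ∣)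
  (solve 3 (λ p q r → (p :- q) :+ (q :- r) := p :- r) refl p q r)
  (ℚP.∣p+q∣≤∣p∣+∣q∣ (p ℚ.- q) (q ℚ.- r))

p≤∣p∣ : ∀ p → p ℚ.≤ ℚ.∣ p ∣
p≤∣p∣ p with ℚP.≤-total 0ℚ p
... | inj₁ 0≤p = ℚP.≤-reflexive (sym (ℚP.0≤p⇒∣p∣≡p 0≤p))
... | inj₂ p≤0 = ℚP.≤-trans p≤0 (ℚP.0≤∣p∣ p)

∣-∣<⇒< : ∀ {p q ε} → ℚ.∣ p ℚ.- q ∣ ℚ.< ε → p ℚ.< q ℚ.+ ε
∣-∣<⇒< {p} {q} {ε} h = subst (ℚ._< q ℚ.+ ε) (solve 2 (λ p q → q :+ (p :- q) := p) refl p q)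
  (ℚP.+-monoʳ-< q (ℚP.≤-<-trans (p≤∣p∣ (p ℚ.- q)) h))

∣p∣<ε : ∀ {p ε} → p ℚ.< ε → ℚ.- p ℚ.< ε → ℚ.∣ p ∣ ℚ.< ε
∣p∣<ε {p} p<ε -p<ε with ℚP.∣p∣≡p∨∣p∣≡-p p
... | inj₁ eq = subst (ℚ._< _) (sym eq) p<ε
... | inj₂ eq = subst (ℚ._< _) (sym eq) -p<ε

+ℚ-cancelʳ-< : ∀ r {p q} → p ℚ.+ r ℚ.< q ℚ.+ r → p ℚ.< q
+ℚ-cancelʳ-< r {p} {q} h = subst₂ ℚ._<_ (cancel p) (cancel q) (ℚP.+-monoˡ-< (ℚ.- r) h)
  where
  cancel : ∀ p → (p ℚ.+ r) ℚ.- r ≡ p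
  cancel p = solve 2 (λ p r → (p :+ r) :- r := p) refl p r

≈-pointwise : ∀ {x y} → (∀ n → seq x n ≡ seq y n) → x ≈ y
≈-pointwise {x} {y} eq ε 0<ε = 0 , λ n _ → subst (ℚ._< ε)
  (sym (cong ℚ.∣_∣ (trans (cong (ℚ._- seq y n) (eq n)) (ℚP.+-inverseʳ (seq y n))))) 0<ε

≈-refl : ∀ {x} → x ≈ x
≈-refl {x} = ≈-pointwise {x} {x} λ _ → refl

≈-sym : ∀ {x y} → x ≈ y → y ≈ x
≈-sym {x} {y} x≈y ε 0<ε =
  eventually-map (λ n → subst (ℚ._< ε) (∣-∣-comm (seq x n) (seq y n))) (x≈y ε 0<ε)

≈-trans : ∀ {x y z} → x ≈ y → y ≈ z → x ≈ z
≈-trans {x} {y} {z} x≈y y≈z ε 0<ε = eventually-map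
  (λ n (p , q) → ℚP.≤-<-trans (∣-∣-triangle (seq x n) (seq y n) (seq z n))
    (subst (_ ℚ.<_) (halves ε) (ℚP.+-mono-< p q)))
  (eventually-× (x≈y _ (0<½* 0<ε)) (y≈z _ (0<½* 0<ε)))

bounded : ∀ x → Σ[ B ∈ ℚ ] (0ℚ ℚ.< B × Eventually λ n → ℚ.∣ seq x n ∣ ℚ.< B)
bounded x = 1ℚ ℚ.+ ℚ.∣ seq x N ∣ , ℚP.+-mono-<-≤ 0<1 (ℚP.0≤∣p∣ (seq x N)) , N , λ n n≥ →
  ℚP.≤-<-trans
    (subst (λ q → ℚ.∣ q ∣ ℚ.≤ ℚ.∣ seq x n ℚ.- seq x N ∣ ℚ.+ ℚ.∣ seq x N ∣)
      (solve 2 (λ a b → (a :- b) :+ b := a) refl (seq x n) (seq x N))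
      (ℚP.∣p+q∣≤∣p∣+∣q∣ (seq x n ℚ.- seq x N) (seq x N)))
    (ℚP.+-monoˡ-< ℚ.∣ seq x N ∣ (proj₂ (cauchy x 1ℚ 0<1) n N n≥ ℕP.≤-refl))
  where
  0<1 = ℚP.positive⁻¹ 1ℚ
  N = proj₁ (cauchy x 1ℚ 0<1)

-- l ≈ r is c times u ≈ v.  Operations on ℝ being pointwise, the condition on c is
-- an identity for the ring solver of ℚ.
≈-from : ∀ c {u v l r} → u ≈ v →
         (∀ n → seq l n ℚ.- seq r n ≡ seq c n ℚ.* (seq u n ℚ.- seq v n)) → l ≈ r
≈-from c {u} {v} {l} {r} u≈v eq ε 0<ε =
  let B , 0<B , ∣c∣<B   = bounded c
      1/B , 0<1/B , B/B≡1 = inverseℚ B 0<B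
      δ = 1/B ℚ.* ε
      Bδ≡ε = trans (sym (ℚP.*-assoc B 1/B ε)) (trans (cong (ℚ._* ε) B/B≡1) (ℚP.*-identityˡ ε))
  in eventually-map (λ n (∣c∣<B , ∣u-v∣<δ) → begin-strict
       ℚ.∣ seq l n ℚ.- seq r n ∣                       ≡⟨ cong ℚ.∣_∣ (eq n) ⟩
       ℚ.∣ seq c n ℚ.* (seq u n ℚ.- seq v n) ∣         ≡⟨ ℚP.∣p*q∣≡∣p∣*∣q∣ (seq c n) _ ⟩
       ℚ.∣ seq c n ∣ ℚ.* ℚ.∣ seq u n ℚ.- seq v n ∣     ≤⟨ ℚP.*-monoʳ-≤-nonNeg _ {{ℚP.∣-∣-nonNeg (seq u n ℚ.- seq v n)}} (ℚP.<⇒≤ ∣c∣<B) ⟩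
       B ℚ.* ℚ.∣ seq u n ℚ.- seq v n ∣                 <⟨ ℚP.*-monoʳ-<-pos B {{ℚ.positive 0<B}} ∣u-v∣<δ ⟩
       B ℚ.* δ                                         ≡⟨ Bδ≡ε ⟩
       ε ∎)
     (eventually-× ∣c∣<B (u≈v δ (0<*ℚ 0<1/B 0<ε)))
  where open ℚP.≤-Reasoning

-- Goes through `m`, which differs from `l` by `c` times the first difference and from `r` by `c′`
-- times the second.
≈-from₂ : ∀ c {u v} c′ {u′ v′ l r} → u ≈ v → u′ ≈ v′ →
          (∀ n → seq l n ℚ.- seq r n ≡ seq c n ℚ.* (seq u n ℚ.- seq v n)
                                   ℚ.+ seq c′ n ℚ.* (seq u′ n ℚ.- seq v′ n)) → l ≈ r
≈-from₂ c {u} {v} c′ {u′} {v′} {l} {r} u≈v u′≈v′ eq = ≈-trans {l} {m} {r}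
  (≈-from c {u} {v} {l} {m} u≈v λ n → trans
    (solve 3 (λ l r s → l :- (r :+ s) := (l :- r) :- s) refl (seq l n) (seq r n) _)
    (trans (cong (ℚ._- _) (eq n)) (solve 2 (λ a b → (a :+ b) :- b := a) refl _ _)))
  (≈-from c′ {u′} {v′} {m} {r} u′≈v′ λ n → solve 2 (λ r s → (r :+ s) :- r := s) refl (seq r n) _)
  where m = r + c′ * (u′ - v′)

+-cong : ∀ {x x′ y y′} → x ≈ x′ → y ≈ y′ → x + y ≈ x′ + y′
+-cong {x} {x′} {y} {y′} x≈ y≈ = ≈-from₂ 1ℝ {x} {x′} 1ℝ {y} {y′} {x + y} {x′ + y′} x≈ y≈ λ n →
  solve 4 (λ x x′ y y′ → (x :+ y) :- (x′ :+ y′) := con 1ℚ :* (x :- x′) :+ con 1ℚ :* (y :- y′))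
    refl (seq x n) (seq x′ n) (seq y n) (seq y′ n)

neg-cong : ∀ {x y} → x ≈ y → - x ≈ - y
neg-cong {x} {y} x≈y = ≈-from (- 1ℝ) {x} {y} {(- x)} {(- y)} x≈y λ n →
  solve 2 (λ x y → (:- x) :- (:- y) := con (ℚ.- 1ℚ) :* (x :- y)) refl (seq x n) (seq y n)

0<⇒bound : ∀ {x} → 0ℝ < x → ∃[ ε ] (0ℚ ℚ.< ε × Eventually λ n → ε ℚ.< seq x n)
0<⇒bound {x} (ε , 0<ε , ev) = ε , 0<ε , eventually-map (λ n → subst (ℚ._< seq x n) (ℚP.+-identityˡ ε)) ev

bound⇒0< : ∀ {x ε} → 0ℚ ℚ.< ε → Eventually (λ n → ε ℚ.< seq x n) → 0ℝ < x
bound⇒0< {x} {ε} 0<ε ev = ε , 0<ε , eventually-map (λ n → subst (ℚ._< seq x n) (sym (ℚP.+-identityˡ ε))) ev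

<⇒0<- : ∀ {x y} → x < y → 0ℝ < y - x
<⇒0<- {x} {y} (ε , 0<ε , ev) = bound⇒0< {y - x} 0<ε (eventually-map (λ n x+ε<y →
  subst (ℚ._< seq y n ℚ.- seq x n)
    (solve 2 (λ x ε → (x :+ ε) :- x := ε) refl (seq x n) ε)
    (ℚP.+-monoˡ-< (ℚ.- seq x n) x+ε<y)) ev)

0<-⇒< : ∀ {x y z} → 0ℝ < z → (∀ n → seq y n ℚ.- seq x n ≡ seq z n) → x < y
0<-⇒< {x} {y} {z} 0<z eq =
  let ε , 0<ε , ev = 0<⇒bound {z} 0<z in
  ε , 0<ε , eventually-map (λ n ε<z → subst (seq x n ℚ.+ ε ℚ.<_)
    (trans (cong (seq x n ℚ.+_) (sym (eq n)))
           (solve 2 (λ x y → x :+ (y :- x) := y) refl (seq x n) (seq y n)))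
    (ℚP.+-monoʳ-< (seq x n) ε<z)) ev

0<-resp : ∀ {x y} → x ≈ y → 0ℝ < x → 0ℝ < y
0<-resp {x} {y} x≈y 0<x =
  let ε , 0<ε , ev = 0<⇒bound {x} 0<x in
  bound⇒0< {y} (0<½* 0<ε) (eventually-map
    (λ n (ε<x , close) → +ℚ-cancelʳ-< (½ ℚ.* ε)
       (subst (ℚ._< seq y n ℚ.+ ½ ℚ.* ε) (sym (halves ε)) (ℚP.<-trans ε<x (∣-∣<⇒< close))))
    (eventually-× ev (x≈y _ (0<½* 0<ε))))

0<-+ : ∀ {x y} → 0ℝ < x → 0ℝ < y → 0ℝ < x + y
0<-+ {x} {y} 0<x 0<y =
  let ε , 0<ε , ev = 0<⇒bound {x} 0<x
      δ , 0<δ , ev′ = 0<⇒bound {y} 0<y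
  in bound⇒0< {x + y} (ℚP.+-mono-< 0<ε 0<δ)
       (eventually-map (λ n (p , q) → ℚP.+-mono-< p q) (eventually-× ev ev′))

0<-* : ∀ {x y} → 0ℝ < x → 0ℝ < y → 0ℝ < x * y
0<-* {x} {y} 0<x 0<y =
  let ε , 0<ε , ev = 0<⇒bound {x} 0<x
      δ , 0<δ , ev′ = 0<⇒bound {y} 0<y
  in bound⇒0< {x * y} (0<*ℚ 0<ε 0<δ) (eventually-map
       (λ n (ε<x , δ<y) → ℚP.<-trans
          (ℚP.*-monoʳ-<-pos ε {{ℚ.positive 0<ε}} δ<y)
          (ℚP.*-monoˡ-<-pos (seq y n) {{ℚ.positive (ℚP.<-trans 0<δ δ<y)}} ε<x))
       (eventually-× ev ev′))

<-irrefl : ∀ {x y} → x ≈ y → ¬ (x < y)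
<-irrefl {x} {y} x≈y x<y =
  let ε , 0<ε , ev = 0<⇒bound {0ℝ} (0<-resp {y - x} {0ℝ} y-x≈0 (<⇒0<- {x} {y} x<y))
  in ℚP.<-asym 0<ε (proj₂ (eventually⇒∃ ev))
  where
  y-x≈0 : y - x ≈ 0ℝ
  y-x≈0 = ≈-from (- 1ℝ) {x} {y} {y - x} {0ℝ} x≈y λ n →
    solve 2 (λ x y → (y :- x) :- con 0ℚ := con (ℚ.- 1ℚ) :* (x :- y)) refl (seq x n) (seq y n)

<-trans : ∀ {x y z} → x < y → y < z → x < z
<-trans {x} {y} {z} x<y y<z = 0<-⇒< {x} {z} {(y - x) + (z - y)}
  (0<-+ {y - x} {z - y} (<⇒0<- {x} {y} x<y) (<⇒0<- {y} {z} y<z))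
  λ n → solve 3 (λ x y z → z :- x := (y :- x) :+ (z :- y)) refl (seq x n) (seq y n) (seq z n)

-- Past `N` the difference of the two reals varies by less than `½ * ε`. One term of it that reached
-- `ε` there would keep all terms past `N` above `½ * ε`, and the difference would be positive. Only
-- rationals are compared, hence no double negation.
≮≯⇒≈ : ∀ {x y} → ¬ (x < y) → ¬ (y < x) → x ≈ y
≮≯⇒≈ {x} {y} x≮y y≮x ε 0<ε = N , λ n n≥ → ∣p∣<ε {seq z n}
    (below z (λ 0<z → y≮x (0<-⇒< {y} {x} {z} 0<z λ _ → refl)) N (proj₂ c) n n≥)
    (subst (ℚ._< ε) (sym (negate n))
      (below z′ (λ 0<z → x≮y (0<-⇒< {x} {y} {z′} 0<z λ _ → refl)) N
        (λ i j i≥ j≥ → subst (ℚ._< ½ ℚ.* ε) (flip i j) (proj₂ c i j i≥ j≥)) n n≥))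
  where
  z z′ : ℝ
  z = x - y
  z′ = y - x

  c = cauchy z _ (0<½* 0<ε)
  N = proj₁ c

  negate : ∀ n → ℚ.- (seq x n ℚ.- seq y n) ≡ seq y n ℚ.- seq x n
  negate n = solve 2 (λ x y → :- (x :- y) := y :- x) refl (seq x n) (seq y n)

  flip : ∀ i j → ℚ.∣ seq z i ℚ.- seq z j ∣ ≡ ℚ.∣ seq z′ i ℚ.- seq z′ j ∣
  flip i j = trans (∣-∣-comm (seq z i) (seq z j)) (cong ℚ.∣_∣
    (solve 4 (λ x y x′ y′ → (x′ :- y′) :- (x :- y) := (y :- x) :- (y′ :- x′)) refl
      (seq x i) (seq y i) (seq x j) (seq y j)))

  below : ∀ w → ¬ (0ℝ < w) → ∀ N →
          (∀ i j → N ℕ.≤ i → N ℕ.≤ j → ℚ.∣ seq w i ℚ.- seq w j ∣ ℚ.< ½ ℚ.* ε) →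
          ∀ n → N ℕ.≤ n → seq w n ℚ.< ε
  below w w≯0 N close n n≥ with seq w n ℚP.<? ε
  ... | yes w<ε = w<ε
  ... | no  w≮ε = ⊥-elim (w≯0 (bound⇒0< {w} (0<½* 0<ε) (N , λ m m≥ →
    +ℚ-cancelʳ-< (½ ℚ.* ε) (ℚP.≤-<-trans
      (subst (ℚ._≤ seq w n) (sym (halves ε)) (ℚP.≮⇒≥ w≮ε))
      (∣-∣<⇒< (close n m n≥ m≥))))))

-- The sign of a Cauchy real cannot be decided, but on the way to `⊥` it may be: once both strict
-- inequalities are refuted, `≮≯⇒≈` proves equality.
by-cases : ∀ x → (x < 0ℝ → ⊥) → (x ≈ 0ℝ → ⊥) → (0ℝ < x → ⊥) → ⊥
by-cases x neg zer pos = zer (≮≯⇒≈ {x} {0ℝ} neg pos)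

<0⇒0<- : ∀ {x} → x < 0ℝ → 0ℝ < - x
<0⇒0<- {x} x<0 = 0<-resp {0ℝ - x} {(- x)} (≈-pointwise {0ℝ - x} {(- x)} λ n → ℚP.+-identityˡ _) (<⇒0<- {x} {0ℝ} x<0)

0<-⇒<0 : ∀ {x} → 0ℝ < - x → x < 0ℝ
0<-⇒<0 {x} 0<-x = 0<-⇒< {x} {0ℝ} {(- x)} 0<-x λ n → ℚP.+-identityˡ _

<-asym : ∀ {x y} → x < y → ¬ (y < x)
<-asym {x} {y} x<y y<x = <-irrefl {x} {x} (≈-refl {x}) (<-trans {x} {y} {x} x<y y<x)

<⇒≤ : ∀ {x y} → x < y → x ≤ y
<⇒≤ {x} {y} = <-asym {x} {y}

<-respˡ : ∀ {x y z} → x ≈ y → x < z → y < z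
<-respˡ {x} {y} {z} x≈y x<z = 0<-⇒< {y} {z} {z - y}
  (0<-resp {z - x} {z - y} (+-cong {z} {z} {(- x)} {(- y)} (≈-refl {z}) (neg-cong {x} {y} x≈y)) (<⇒0<- {x} {z} x<z))
  λ _ → refl

<-respʳ : ∀ {x y z} → x ≈ y → z < x → z < y
<-respʳ {x} {y} {z} x≈y z<x = 0<-⇒< {z} {y} {y - z}
  (0<-resp {x - z} {y - z} (+-cong {x} {y} {(- z)} {(- z)} x≈y (≈-refl {(- z)})) (<⇒0<- {z} {x} z<x))
  λ _ → refl

≈⇒≤ : ∀ {x y} → x ≈ y → x ≤ y
≈⇒≤ {x} {y} x≈y = <-irrefl {y} {x} (≈-sym {x} {y} x≈y)

0≤-resp : ∀ {x y} → x ≈ y → 0ℝ ≤ x → 0ℝ ≤ y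
0≤-resp {x} {y} x≈y 0≤x y<0 = 0≤x (<-respˡ {y} {x} {0ℝ} (≈-sym {x} {y} x≈y) y<0)

0≤-cases : ∀ {x} → 0ℝ ≤ x → (x ≈ 0ℝ → ⊥) → (0ℝ < x → ⊥) → ⊥
0≤-cases {x} 0≤x = by-cases x 0≤x

-- Cases are legitimate because the goal `0ℝ ≤ z` is itself a negation.
0≤-elim₂ : ∀ {x y z} → 0ℝ ≤ x → 0ℝ ≤ y →
           (x ≈ 0ℝ → 0ℝ ≤ z) → (y ≈ 0ℝ → 0ℝ ≤ z) → (0ℝ < x → 0ℝ < y → 0ℝ ≤ z) → 0ℝ ≤ z
0≤-elim₂ {x} {y} 0≤x 0≤y f g h z<0 =
  0≤-cases {x} 0≤x (λ x≈0 → f x≈0 z<0) λ 0<x →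
  0≤-cases {y} 0≤y (λ y≈0 → g y≈0 z<0) λ 0<y → h 0<x 0<y z<0

0≤-+ : ∀ {x y} → 0ℝ ≤ x → 0ℝ ≤ y → 0ℝ ≤ x + y
0≤-+ {x} {y} 0≤x 0≤y = 0≤-elim₂ {x} {y} {x + y} 0≤x 0≤y
  (λ x≈0 → 0≤-resp {y} {x + y} (≈-from (- 1ℝ) {x} {0ℝ} {y} {x + y} x≈0 λ n →
     solve 2 (λ x y → y :- (x :+ y) := con (ℚ.- 1ℚ) :* (x :- con 0ℚ)) refl (seq x n) (seq y n)) 0≤y)
  (λ y≈0 → 0≤-resp {x} {x + y} (≈-from (- 1ℝ) {y} {0ℝ} {x} {x + y} y≈0 λ n →
     solve 2 (λ x y → x :- (x :+ y) := con (ℚ.- 1ℚ) :* (y :- con 0ℚ)) refl (seq x n) (seq y n)) 0≤x)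
  (λ 0<x 0<y → <⇒≤ {0ℝ} {x + y} (0<-+ {x} {y} 0<x 0<y))

0≤-* : ∀ {x y} → 0ℝ ≤ x → 0ℝ ≤ y → 0ℝ ≤ x * y
0≤-* {x} {y} 0≤x 0≤y = 0≤-elim₂ {x} {y} {x * y} 0≤x 0≤y
  (λ x≈0 → ≈⇒≤ {0ℝ} {x * y} (≈-from (- y) {x} {0ℝ} {0ℝ} {x * y} x≈0 λ n →
     solve 2 (λ x y → con 0ℚ :- (x :* y) := (:- y) :* (x :- con 0ℚ)) refl (seq x n) (seq y n)))
  (λ y≈0 → ≈⇒≤ {0ℝ} {x * y} (≈-from (- x) {y} {0ℝ} {0ℝ} {x * y} y≈0 λ n →
     solve 2 (λ x y → con 0ℚ :- (x :* y) := (:- x) :* (y :- con 0ℚ)) refl (seq x n) (seq y n)))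
  (λ 0<x 0<y → <⇒≤ {0ℝ} {x * y} (0<-* {x} {y} 0<x 0<y))

≤⇒0≤- : ∀ {x y} → x ≤ y → 0ℝ ≤ y - x
≤⇒0≤- {x} {y} x≤y y-x<0 = x≤y (0<-⇒< {y} {x} {(- (y - x))} (<0⇒0<- {y - x} y-x<0)
  λ n → solve 2 (λ x y → x :- y := :- (y :- x)) refl (seq x n) (seq y n))

0≤-⇒≤ : ∀ {x y z} → 0ℝ ≤ z → (∀ n → seq y n ℚ.- seq x n ≡ seq z n) → x ≤ y
0≤-⇒≤ {x} {y} {z} 0≤z eq y<x = 0≤-resp {z} {y - x}
  (≈-pointwise {z} {y - x} λ n → sym (eq n)) 0≤z
  (0<-⇒<0 {y - x} (0<-resp {x - y} {(- (y - x))}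
    (≈-pointwise {x - y} {(- (y - x))} λ n → solve 2 (λ x y → x :- y := :- (y :- x)) refl (seq x n) (seq y n))
    (<⇒0<- {y} {x} y<x)))

≰⇒≥ : ∀ {x y} → ¬ (x ≤ y) → y ≤ x
≰⇒≥ {x} {y} x≰y x<y = x≰y (<⇒≤ {x} {y} x<y)

inverse : ∀ {x} → 0ℝ < x → ∃[ y ] (0ℝ ≤ y × x * y ≈ 1ℝ)
inverse {x} 0<x = y , y≥0 , xy≈1
  where
  b = 0<⇒bound {x} 0<x
  ε = proj₁ b
  0<ε = proj₁ (proj₂ b)
  N = proj₁ (proj₂ (proj₂ b))

  -- Finitely many terms of `x` may be zero or negative. The maximum with the lower bound `ε` makes
  -- every term invertible and changes nothing from `N` on.
  0<m : ∀ n → 0ℚ ℚ.< seq x n ℚ.⊔ ε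
  0<m n = ℚP.<-≤-trans 0<ε (ℚP.p≤q⊔p (seq x n) ε)

  1/m : ℕ → ℚ
  1/m n = proj₁ (inverseℚ (seq x n ℚ.⊔ ε) (0<m n))

  0<1/m : ∀ n → 0ℚ ℚ.< 1/m n
  0<1/m n = proj₁ (proj₂ (inverseℚ (seq x n ℚ.⊔ ε) (0<m n)))

  x/m≡1 : ∀ n → N ℕ.≤ n → seq x n ℚ.* 1/m n ≡ 1ℚ
  x/m≡1 n n≥ = trans (cong (ℚ._* 1/m n) (sym (ℚP.p≥q⇒p⊔q≡p (ℚP.<⇒≤ (proj₂ (proj₂ (proj₂ b)) n n≥)))))
    (proj₂ (proj₂ (inverseℚ (seq x n ℚ.⊔ ε) (0<m n))))

  K = proj₁ (inverseℚ ε 0<ε)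
  0<K = proj₁ (proj₂ (inverseℚ ε 0<ε))
  εK≡1 = proj₂ (proj₂ (inverseℚ ε 0<ε))

  ∣1/m∣<K : ∀ n → N ℕ.≤ n → ℚ.∣ 1/m n ∣ ℚ.≤ K
  ∣1/m∣<K n n≥ = begin
    ℚ.∣ 1/m n ∣             ≡⟨ ℚP.0≤p⇒∣p∣≡p (ℚP.<⇒≤ (0<1/m n)) ⟩
    1/m n                   ≡⟨ trans (cong (ℚ._* 1/m n) εK≡1) (ℚP.*-identityˡ (1/m n)) ⟨
    (ε ℚ.* K) ℚ.* 1/m n     ≡⟨ solve 3 (λ ε K m → (ε :* K) :* m := K :* (ε :* m)) refl ε K (1/m n) ⟩
    K ℚ.* (ε ℚ.* 1/m n)     ≤⟨ ℚP.*-monoˡ-≤-nonNeg K {{ℚ.nonNegative (ℚP.<⇒≤ 0<K)}}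
                                (ℚP.*-monoʳ-≤-nonNeg (1/m n) {{ℚ.nonNegative (ℚP.<⇒≤ (0<1/m n))}}
                                  (ℚP.<⇒≤ (proj₂ (proj₂ (proj₂ b)) n n≥))) ⟩
    K ℚ.* (seq x n ℚ.* 1/m n) ≡⟨ trans (cong (K ℚ.*_) (x/m≡1 n n≥)) (ℚP.*-identityʳ K) ⟩
    K ∎
    where open ℚP.≤-Reasoning

  difference : ∀ i j → N ℕ.≤ i → N ℕ.≤ j →
               1/m i ℚ.- 1/m j ≡ (1/m i ℚ.* 1/m j) ℚ.* (seq x j ℚ.- seq x i)
  difference i j i≥ j≥ = sym (trans
    (solve 4 (λ a b p q → (a :* b) :* (q :- p) := a :* (q :* b) :- (p :* a) :* b) refl
      (1/m i) (1/m j) (seq x i) (seq x j))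
    (trans (cong₂ (λ s t → 1/m i ℚ.* s ℚ.- t ℚ.* 1/m j) (x/m≡1 j j≥) (x/m≡1 i i≥))
      (cong₂ ℚ._-_ (ℚP.*-identityʳ (1/m i)) (ℚP.*-identityˡ (1/m j)))))

  -- From `N` on the inverses are at most `K`, the inverse of `ε`, so inversion stretches distances
  -- at most by `K * K`; `D` undoes this factor.
  c : Cauchy 1/m
  c η 0<η =
    let D , 0<D , KKD≡1 = inverseℚ (K ℚ.* K) (0<*ℚ 0<K 0<K)
        M , close = cauchy x (D ℚ.* η) (0<*ℚ 0<D 0<η)
    in N ℕ.⊔ M , λ i j i≥ j≥ →
      let i≥N = ℕP.m⊔n≤o⇒m≤o N M i≥
          j≥N = ℕP.m⊔n≤o⇒m≤o N M j≥
      in begin-strict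
      ℚ.∣ 1/m i ℚ.- 1/m j ∣
        ≡⟨ cong ℚ.∣_∣ (difference i j i≥N j≥N) ⟩
      ℚ.∣ (1/m i ℚ.* 1/m j) ℚ.* (seq x j ℚ.- seq x i) ∣
        ≡⟨ trans (ℚP.∣p*q∣≡∣p∣*∣q∣ (1/m i ℚ.* 1/m j) _)
                 (cong (ℚ._* ℚ.∣ seq x j ℚ.- seq x i ∣) (ℚP.∣p*q∣≡∣p∣*∣q∣ (1/m i) (1/m j))) ⟩
      (ℚ.∣ 1/m i ∣ ℚ.* ℚ.∣ 1/m j ∣) ℚ.* ℚ.∣ seq x j ℚ.- seq x i ∣
        ≤⟨ ℚP.*-monoʳ-≤-nonNeg ℚ.∣ seq x j ℚ.- seq x i ∣ {{ℚP.∣-∣-nonNeg (seq x j ℚ.- seq x i)}}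
             (ℚP.≤-trans
               (ℚP.*-monoʳ-≤-nonNeg ℚ.∣ 1/m j ∣ {{ℚP.∣-∣-nonNeg (1/m j)}} (∣1/m∣<K i i≥N))
               (ℚP.*-monoˡ-≤-nonNeg K {{ℚ.nonNegative (ℚP.<⇒≤ 0<K)}} (∣1/m∣<K j j≥N))) ⟩
      (K ℚ.* K) ℚ.* ℚ.∣ seq x j ℚ.- seq x i ∣
        <⟨ ℚP.*-monoʳ-<-pos (K ℚ.* K) {{ℚ.positive (0<*ℚ 0<K 0<K)}}
             (close j i (ℕP.m⊔n≤o⇒n≤o N M j≥) (ℕP.m⊔n≤o⇒n≤o N M i≥)) ⟩
      (K ℚ.* K) ℚ.* (D ℚ.* η)
        ≡⟨ trans (sym (ℚP.*-assoc (K ℚ.* K) D η))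
                 (trans (cong (ℚ._* η) KKD≡1) (ℚP.*-identityˡ η)) ⟩
      η ∎
    where open ℚP.≤-Reasoning

  y : ℝ
  y = mkℝ 1/m c

  y≥0 : 0ℝ ≤ y
  y≥0 (δ , 0<δ , ev) =
    let n , h = eventually⇒∃ ev
    in ℚP.<-asym (ℚP.+-mono-< (0<1/m n) 0<δ) (subst (1/m n ℚ.+ δ ℚ.<_) (sym (ℚP.+-identityʳ 0ℚ)) h)

  xy≈1 : x * y ≈ 1ℝ
  xy≈1 η 0<η = N , λ n n≥ → subst (ℚ._< η)
    (sym (cong ℚ.∣_∣ (trans (cong (ℚ._- 1ℚ) (x/m≡1 n n≥)) (ℚP.+-inverseʳ 1ℚ)))) 0<η

0<-cancel : ∀ {x y} → 0ℝ < x → x * y ≈ 0ℝ → y ≈ 0ℝ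
0<-cancel {x} {y} 0<x xy≈0 =
  let z , _ , xz≈1 = inverse {x} 0<x
  in ≈-from₂ z {x * y} {0ℝ} (- y) {x * z} {1ℝ} {y} {0ℝ} xy≈0 xz≈1 λ n →
       solve 3 (λ x y z → y :- con 0ℚ := z :* (x :* y :- con 0ℚ) :+ (:- y) :* (x :* z :- con 1ℚ)) refl
         (seq x n) (seq y n) (seq z n)

-- Segments that stab a common segment

-- By `≮≯⇒≈` equality amounts to two negations, so an equality obtained from cases under a double
-- negation can be kept.
≈-stable : ∀ {x y} → ¬ ¬ (x ≈ y) → x ≈ y
≈-stable {x} {y} ¬¬x≈y = ≮≯⇒≈ {x} {y}
  (λ x<y → ¬¬x≈y λ x≈y → <-irrefl {x} {y} x≈y x<y)
  (λ y<x → ¬¬x≈y λ x≈y → <-irrefl {y} {x} (≈-sym {x} {y} x≈y) y<x)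

0<-+-0≤ : ∀ {x y} → 0ℝ < x → 0ℝ ≤ y → ¬ ¬ (0ℝ < x + y)
0<-+-0≤ {x} {y} 0<x 0≤y k = 0≤-cases {y} 0≤y
  (λ y≈0 → k (0<-resp {x} {x + y} (≈-from (- 1ℝ) {y} {0ℝ} {x} {x + y} y≈0 λ n →
     solve 2 (λ x y → x :- (x :+ y) := con (ℚ.- 1ℚ) :* (y :- con 0ℚ)) refl (seq x n) (seq y n)) 0<x))
  (λ 0<y → k (0<-+ {x} {y} 0<x 0<y))

0≤-square : ∀ x → 0ℝ ≤ x * x
0≤-square x x²<0 = by-cases x
  (λ x<0 → let 0<-x = <0⇒0<- {x} x<0 in
     <⇒≤ {0ℝ} {x * x} (0<-resp {(- x) * (- x)} {x * x} (≈-pointwise {(- x) * (- x)} {x * x} λ n →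
       solve 1 (λ x → (:- x) :* (:- x) := x :* x) refl (seq x n)) (0<-* {(- x)} {(- x)} 0<-x 0<-x)) x²<0)
  (λ x≈0 → 0≤-* {x} {x} (≈⇒≤ {0ℝ} {x} (≈-sym {x} {0ℝ} x≈0)) (≈⇒≤ {0ℝ} {x} (≈-sym {x} {0ℝ} x≈0)) x²<0)
  (λ 0<x → <⇒≤ {0ℝ} {x * x} (0<-* {x} {x} 0<x 0<x) x²<0)

square-+≈0 : ∀ x y → x * x + y * y ≈ 0ℝ → x ≈ 0ℝ
square-+≈0 x y sum≈0 = ≈-stable {x} {0ℝ} λ x≉0 →
  0≤-cases {x * x} (0≤-square x)
    (λ x²≈0 → by-cases x
      (λ x<0 → let 0<-x = <0⇒0<- {x} x<0 in x≉0 (0<-cancel₋ 0<-x x²≈0))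
      x≉0
      (λ 0<x → x≉0 (0<-cancel {x} {x} 0<x x²≈0)))
    (λ 0<x² → 0<-+-0≤ {x * x} {y * y} 0<x² (0≤-square y) λ 0<sum →
      <-irrefl {0ℝ} {x * x + y * y} (≈-sym {x * x + y * y} {0ℝ} sum≈0) 0<sum)
  where
  0<-cancel₋ : 0ℝ < - x → x * x ≈ 0ℝ → x ≈ 0ℝ
  0<-cancel₋ 0<-x x²≈0 = 0<-cancel {(- x)} {x} 0<-x
    (≈-from (- 1ℝ) {x * x} {0ℝ} {(- x) * x} {0ℝ} x²≈0 λ n →
      solve 1 (λ x → (:- x) :* x :- con 0ℚ := con (ℚ.- 1ℚ) :* (x :* x :- con 0ℚ)) refl (seq x n))

UnitInterval : ℝ → Set
UnitInterval a = 0ℝ ≤ a × a ≤ 1ℝ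

lerp : Point → Point → ℝ → Point
lerp P Q a = P +ᵖ a *ᵖ (Q -ᵖ P)

segment-convex : ∀ S {P Q a} → P ∈ segment S → Q ∈ segment S → UnitInterval a →
                 lerp P Q a ∈ segment S
segment-convex S {P} {Q} {a} (u , 0≤u , u≤1 , u-x , u-y) (v , 0≤v , v≤1 , v-x , v-y) (0≤a , a≤1) =
  w ,
  0≤-resp {(1ℝ - a) * u + a * v} {w}
    (≈-pointwise {(1ℝ - a) * u + a * v} {w} λ n →
      solve 3 (λ u v a → (con 1ℚ :- a) :* u :+ a :* v := u :+ a :* (v :- u)) refl (seq u n) (seq v n) (seq a n))
    (0≤-+ {(1ℝ - a) * u} {a * v} (0≤-* {1ℝ - a} {u} 0≤1-a 0≤u) (0≤-* {a} {v} 0≤a 0≤v)) ,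
  0≤-⇒≤ {w} {1ℝ} {(1ℝ - a) * (1ℝ - u) + a * (1ℝ - v)}
    (0≤-+ {(1ℝ - a) * (1ℝ - u)} {a * (1ℝ - v)}
      (0≤-* {1ℝ - a} {1ℝ - u} 0≤1-a (≤⇒0≤- {u} {1ℝ} u≤1))
      (0≤-* {a} {1ℝ - v} 0≤a (≤⇒0≤- {v} {1ℝ} v≤1)))
    (λ n → solve 3 (λ u v a → con 1ℚ :- (u :+ a :* (v :- u))
                          := (con 1ℚ :- a) :* (con 1ℚ :- u) :+ a :* (con 1ℚ :- v))
             refl (seq u n) (seq v n) (seq a n)) ,
  coordinate (proj₁ start) (proj₁ end) (proj₁ P) (proj₁ Q) u-x v-x ,
  coordinate (proj₂ start) (proj₂ end) (proj₂ P) (proj₂ Q) u-y v-y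
  where
  open Segment S
  w : ℝ
  w = u + a * (v - u)

  0≤1-a : 0ℝ ≤ 1ℝ - a
  0≤1-a = ≤⇒0≤- {a} {1ℝ} a≤1

  coordinate : ∀ s e p q → s + u * (e - s) ≈ p → s + v * (e - s) ≈ q →
               s + w * (e - s) ≈ p + a * (q - p)
  coordinate s e p q p≈ q≈ =
    ≈-from₂ (1ℝ - a) {s + u * (e - s)} {p} a {s + v * (e - s)} {q}
      {s + w * (e - s)} {p + a * (q - p)} p≈ q≈ λ n →
      solve 7 (λ s e p q u v a →
          s :+ (u :+ a :* (v :- u)) :* (e :- s) :- (p :+ a :* (q :- p))
          := (con 1ℚ :- a) :* (s :+ u :* (e :- s) :- p) :+ a :* (s :+ v :* (e :- s) :- q))
        refl (seq s n) (seq e n) (seq p n) (seq q n) (seq u n) (seq v n) (seq a n)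

≈ᵖ-sym : ∀ {P Q} → P ≈ᵖ Q → Q ≈ᵖ P
≈ᵖ-sym {x , y} {x′ , y′} (p , q) = ≈-sym {x} {x′} p , ≈-sym {y} {y′} q

≈ᵖ-trans : ∀ {P Q R} → P ≈ᵖ Q → Q ≈ᵖ R → P ≈ᵖ R
≈ᵖ-trans {x , y} {x′ , y′} {x″ , y″} (p , q) (p′ , q′) =
  ≈-trans {x} {x′} {x″} p p′ , ≈-trans {y} {y′} {y″} q q′

segment-resp : ∀ S {P Q} → P ≈ᵖ Q → P ∈ segment S → Q ∈ segment S
segment-resp S {P} {Q} P≈Q (t , 0≤t , t≤1 , eq) =
  t , 0≤t , t≤1 , ≈ᵖ-trans {start +ᵖ t *ᵖ (end -ᵖ start)} {P} {Q} eq P≈Q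
  where open Segment S

-- The segment from (t , 0) to (q , h) meets the one from (t′ , 0) to (q′ , h′).
Crossing : (t q h t′ q′ h′ : ℝ) → Set
Crossing t q h t′ q′ h′ = ∃[ a ] ∃[ b ] (UnitInterval a × UnitInterval b ×
  t + a * (q - t) ≈ t′ + b * (q′ - t′) × a * h ≈ b * h′)

-- If β h = α h′, the point α / β of the way from (t′ , 0) to (q′ , h′) has height h,
-- and e / β is the distance from it to (q , h), which lies on its right if 0 ≤ e.
module Offset (t q h t′ q′ h′ α β : ℝ) where
  e : ℝ
  e = β * (q - t′) - α * (q′ - t′)

  -- The point at fraction `a` of the first path is as high as the point at fraction `a * α / β` of
  -- the second. Their horizontal offset is affine in `a`, from `- δ` at 0 to `e / β` at 1, hence
  -- vanishes at `a = β * δ / D`.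
  crossing : t < t′ → 0ℝ < β → 0ℝ ≤ α → α ≤ β → β * h ≈ α * h′ → 0ℝ ≤ e →
             (Crossing t q h t′ q′ h′ → ⊥) → ⊥
  crossing t<t′ 0<β 0≤α α≤β βh≈αh′ 0≤e k =
    0<-+-0≤ {β * δ} {e} (0<-* {β} {δ} 0<β 0<δ) 0≤e λ 0<D → k (cross 0<D)
    where
    δ D : ℝ
    δ = t′ - t
    D = β * δ + e

    0<δ : 0ℝ < δ
    0<δ = <⇒0<- {t} {t′} t<t′

    0≤δ : 0ℝ ≤ δ
    0≤δ = <⇒≤ {0ℝ} {δ} 0<δ

    cross : 0ℝ < D → Crossing t q h t′ q′ h′
    cross 0<D = a , b ,
      ( 0≤-* {β * δ} {I} (0≤-* {β} {δ} (<⇒≤ {0ℝ} {β} 0<β) 0≤δ) 0≤I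
      , 0≤-⇒≤ {a} {1ℝ} {1ℝ - a} (0≤-resp {e * I} {1ℝ - a}
          (≈-from 1ℝ {D * I} {1ℝ} {e * I} {1ℝ - a} DI≈1 λ n →
            solve 4 (λ β δ e I → e :* I :- (con 1ℚ :- β :* δ :* I)
                              := con 1ℚ :* ((β :* δ :+ e) :* I :- con 1ℚ))
              refl (seq β n) (seq δ n) (seq e n) (seq I n))
          (0≤-* {e} {I} 0≤e 0≤I)) (λ _ → refl) ) ,
      ( 0≤-* {α * δ} {I} (0≤-* {α} {δ} 0≤α 0≤δ) 0≤I
      , 0≤-⇒≤ {b} {1ℝ} {1ℝ - b} (0≤-resp {((β - α) * δ + e) * I} {1ℝ - b}
          (≈-from 1ℝ {D * I} {1ℝ} {((β - α) * δ + e) * I} {1ℝ - b} DI≈1 λ n →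
            solve 5 (λ α β δ e I → ((β :- α) :* δ :+ e) :* I :- (con 1ℚ :- α :* δ :* I)
                                := con 1ℚ :* ((β :* δ :+ e) :* I :- con 1ℚ))
              refl (seq α n) (seq β n) (seq δ n) (seq e n) (seq I n))
          (0≤-* {(β - α) * δ + e} {I}
            (0≤-+ {(β - α) * δ} {e} (0≤-* {β - α} {δ} (≤⇒0≤- {α} {β} α≤β) 0≤δ) 0≤e) 0≤I)) (λ _ → refl) ) ,
      ≈-from δ {D * I} {1ℝ} {t + a * (q - t)} {t′ + b * (q′ - t′)} DI≈1
        (λ n → solve 7 (λ t q t′ q′ α β I →
            t :+ (β :* (t′ :- t) :* I) :* (q :- t) :- (t′ :+ (α :* (t′ :- t) :* I) :* (q′ :- t′))
            := (t′ :- t) :* ((β :* (t′ :- t) :+ (β :* (q :- t′) :- α :* (q′ :- t′))) :* I :- con 1ℚ))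
          refl (seq t n) (seq q n) (seq t′ n) (seq q′ n) (seq α n) (seq β n) (seq I n)) ,
      ≈-from (δ * I) {β * h} {α * h′} {a * h} {b * h′} βh≈αh′
        (λ n → solve 6 (λ δ I α β h h′ → β :* δ :* I :* h :- α :* δ :* I :* h′
                                      := δ :* I :* (β :* h :- α :* h′))
          refl (seq δ n) (seq I n) (seq α n) (seq β n) (seq h n) (seq h′ n))
      where
      inv = inverse {D} 0<D
      I a b : ℝ
      I = proj₁ inv
      a = β * δ * I
      b = α * δ * I
      0≤I = proj₁ (proj₂ inv)
      DI≈1 = proj₂ (proj₂ inv)

Crossing-mirror : ∀ {t q h t′ q′ h′} → Crossing (- t) (- q) h (- t′) (- q′) h′ → Crossing t q h t′ q′ h′
Crossing-mirror {t} {q} {h} {t′} {q′} {h′} (a , b , a∈ , b∈ , eq , heights) = a , b , a∈ , b∈ ,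
  ≈-from (- 1ℝ) {(- t) + a * ((- q) - (- t))} {(- t′) + b * ((- q′) - (- t′))}
    {t + a * (q - t)} {t′ + b * (q′ - t′)} eq
    (λ n → solve 6 (λ t q t′ q′ a b → t :+ a :* (q :- t) :- (t′ :+ b :* (q′ :- t′))
        := con (ℚ.- 1ℚ) :* ((:- t) :+ a :* ((:- q) :- (:- t)) :- ((:- t′) :+ b :* ((:- q′) :- (:- t′)))))
      refl (seq t n) (seq q n) (seq t′ n) (seq q′ n) (seq a n) (seq b n)) ,
  heights

-- A path that starts inside the base of a triangle cannot reach the height of
-- the apex without crossing one of the two other sides.
triangle-trap : ∀ {t₁ t₂ t₃ q h q′ h′} → t₁ < t₂ → t₂ < t₃ → 0ℝ ≤ h → h ≤ h′ →
                ¬ Crossing t₁ q h t₂ q′ h′ → ¬ Crossing t₃ q h t₂ q′ h′ → ⊥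
triangle-trap {t₁} {t₂} {t₃} {q} {h} {q′} {h′} t₁<t₂ t₂<t₃ 0≤h h≤h′ no₁ no₃ =
  by-cases h′
    (λ h′<0 → 0≤-cases {h} 0≤h
      (λ h≈0 → h≤h′ (<-respʳ {0ℝ} {h} {h′} (≈-sym {h} {0ℝ} h≈0) h′<0))
      (λ 0<h → h≤h′ (<-trans {h′} {0ℝ} {h} h′<0 0<h)))
    -- With everything at height 0, the choice `α = 0`, `β = 1` compares the apex with the foot of
    -- the path.
    (λ h′≈0 →
      let h≈0 = ≮≯⇒≈ {h} {0ℝ} 0≤h λ 0<h → h≤h′ (<-respˡ {0ℝ} {h′} {h} (≈-sym {h′} {0ℝ} h′≈0) 0<h)
      in scaled 0ℝ 1ℝ 0<1 (<-irrefl {0ℝ} {0ℝ} (≈-refl {0ℝ})) (<⇒≤ {0ℝ} {1ℝ} 0<1)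
           (≈-from 1ℝ {h} {0ℝ} {1ℝ * h} {0ℝ * h′} h≈0 λ n →
             solve 2 (λ h h′ → con 1ℚ :* h :- con 0ℚ :* h′ := con 1ℚ :* (h :- con 0ℚ)) refl (seq h n) (seq h′ n)))
    -- For `α = h` and `β = h′` the point `α / β` of the way along the path is exactly as high as
    -- the apex.
    (λ 0<h′ → scaled h h′ 0<h′ 0≤h h≤h′
      (≈-pointwise {h′ * h} {h * h′} λ n → ℚP.*-comm (seq h′ n) (seq h n)))
  where
  0<1 : 0ℝ < 1ℝ
  0<1 = bound⇒0< {1ℝ} {½} (ℚP.positive⁻¹ ½) (0 , λ _ _ → ½<1)
    where
    ½<1 : ½ ℚ.< 1ℚ
    ½<1 = ℚP.+-monoʳ-< ½ (ℚP.positive⁻¹ ½)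

  -- The sign of `e` tells on which side of the path the apex lies; the side of the triangle from
  -- the base corner on the other side is then crossed. The right corner is reduced to the left one
  -- by the reflection `x ↦ - x`, under which `e` changes its sign.
  scaled : ∀ α β → 0ℝ < β → 0ℝ ≤ α → α ≤ β → β * h ≈ α * h′ → ⊥
  scaled α β 0<β 0≤α α≤β eq = by-cases e
    (λ e<0 → right (0≤-resp {(- e)} {e₃} e₃≈ (<⇒≤ {0ℝ} {(- e)} (<0⇒0<- {e} e<0))))
    (λ e≈0 → left (≈⇒≤ {0ℝ} {e} (≈-sym {e} {0ℝ} e≈0)))
    (λ 0<e → left (<⇒≤ {0ℝ} {e} 0<e))
    where
    open Offset t₁ q h t₂ q′ h′ α β using (e)
    open Offset (- t₃) (- q) h (- t₂) (- q′) h′ α β using () renaming (e to e₃)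

    e₃≈ : - e ≈ e₃
    e₃≈ = ≈-pointwise {(- e)} {e₃} λ n → solve 5 (λ q q′ t α β →
        :- (β :* (q :- t) :- α :* (q′ :- t)) := β :* ((:- q) :- (:- t)) :- α :* ((:- q′) :- (:- t)))
      refl (seq q n) (seq q′ n) (seq t₂ n) (seq α n) (seq β n)

    left : 0ℝ ≤ e → ⊥
    left 0≤e = Offset.crossing t₁ q h t₂ q′ h′ α β t₁<t₂ 0<β 0≤α α≤β eq 0≤e no₁

    right : 0ℝ ≤ e₃ → ⊥
    right 0≤e₃ = Offset.crossing (- t₃) (- q) h (- t₂) (- q′) h′ α β
      (0<-⇒< {(- t₃)} {(- t₂)} {t₃ - t₂} (<⇒0<- {t₂} {t₃} t₂<t₃) λ n →
        solve 2 (λ t₂ t₃ → (:- t₂) :- (:- t₃) := t₃ :- t₂) refl (seq t₂ n) (seq t₃ n))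
      0<β 0≤α α≤β eq 0≤e₃ λ c → no₃ (Crossing-mirror {t₃} {q} {h} {t₂} {q′} {h′} c)

-- Coordinates along and across a segment, and the order of its stabbers

module Stabbed (U : Segment) where
  open Segment U

  a₁ a₂ d₁ d₂ : ℝ
  a₁ = proj₁ start
  a₂ = proj₂ start
  d₁ = proj₁ end - a₁
  d₂ = proj₂ end - a₂

  -- Inner product and determinant with the direction of `U`: the coordinates along and across `U`,
  -- scaled by its length so that no square root is taken.
  abscissa ordinate : Point → ℝ
  abscissa (x , y) = d₁ * (x - a₁) + d₂ * (y - a₂)
  ordinate (x , y) = d₁ * (y - a₂) - d₂ * (x - a₁)

  0<norm : ¬ ¬ (0ℝ < d₁ * d₁ + d₂ * d₂)
  0<norm = 0≤-cases {d₁ * d₁ + d₂ * d₂} (0≤-+ {d₁ * d₁} {d₂ * d₂} (0≤-square d₁) (0≤-square d₂))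
    λ norm≈0 → proper
      ( collapse a₁ (proj₁ end) (square-+≈0 d₁ d₂ norm≈0)
      , collapse a₂ (proj₂ end) (square-+≈0 d₂ d₁ (≈-trans {d₂ * d₂ + d₁ * d₁} {d₁ * d₁ + d₂ * d₂} {0ℝ}
          (≈-pointwise {d₂ * d₂ + d₁ * d₁} {d₁ * d₁ + d₂ * d₂} λ n → ℚP.+-comm (seq (d₂ * d₂) n) (seq (d₁ * d₁) n)) norm≈0)))
    where
    collapse : ∀ a b → b - a ≈ 0ℝ → a ≈ b
    collapse a b eq = ≈-from (- 1ℝ) {b - a} {0ℝ} {a} {b} eq λ n →
      solve 2 (λ a b → a :- b := con (ℚ.- 1ℚ) :* ((b :- a) :- con 0ℚ)) refl (seq a n) (seq b n)

  -- The linear part of the coordinate change is a rotation scaled by the length of `U`, so its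
  -- transpose inverts it up to the factor `N`. That `N` is positive is known under a double
  -- negation, which suffices since equality is stable.
  coordinates-injective : ∀ {P Q} → abscissa P ≈ abscissa Q → ordinate P ≈ ordinate Q → P ≈ᵖ Q
  coordinates-injective {P@(x , y)} {Q@(x′ , y′)} eq₁ eq₂ =
    (divide x x′ λ 0<N → 0<-cancel {N} {x - x′} 0<N
      (≈-from₂ d₁ {abscissa P} {abscissa Q} (- d₂) {ordinate P} {ordinate Q} {N * (x - x′)} {0ℝ} eq₁ eq₂ λ n →
        solve 8 (λ d₁ d₂ a₁ a₂ x y x′ y′ →
          (d₁ :* d₁ :+ d₂ :* d₂) :* (x :- x′) :- con 0ℚ
          := d₁ :* ((d₁ :* (x :- a₁) :+ d₂ :* (y :- a₂)) :- (d₁ :* (x′ :- a₁) :+ d₂ :* (y′ :- a₂)))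
          :+ (:- d₂) :* ((d₁ :* (y :- a₂) :- d₂ :* (x :- a₁)) :- (d₁ :* (y′ :- a₂) :- d₂ :* (x′ :- a₁))))
        refl (seq d₁ n) (seq d₂ n) (seq a₁ n) (seq a₂ n) (seq x n) (seq y n) (seq x′ n) (seq y′ n))) ,
    (divide y y′ λ 0<N → 0<-cancel {N} {y - y′} 0<N
      (≈-from₂ d₂ {abscissa P} {abscissa Q} d₁ {ordinate P} {ordinate Q} {N * (y - y′)} {0ℝ} eq₁ eq₂ λ n →
        solve 8 (λ d₁ d₂ a₁ a₂ x y x′ y′ →
          (d₁ :* d₁ :+ d₂ :* d₂) :* (y :- y′) :- con 0ℚ
          := d₂ :* ((d₁ :* (x :- a₁) :+ d₂ :* (y :- a₂)) :- (d₁ :* (x′ :- a₁) :+ d₂ :* (y′ :- a₂)))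
          :+ d₁ :* ((d₁ :* (y :- a₂) :- d₂ :* (x :- a₁)) :- (d₁ :* (y′ :- a₂) :- d₂ :* (x′ :- a₁))))
        refl (seq d₁ n) (seq d₂ n) (seq a₁ n) (seq a₂ n) (seq x n) (seq y n) (seq x′ n) (seq y′ n)))
    where
    N : ℝ
    N = d₁ * d₁ + d₂ * d₂

    divide : ∀ u v → (0ℝ < N → u - v ≈ 0ℝ) → u ≈ v
    divide u v f = ≈-stable {u} {v} λ u≉v → 0<norm λ 0<N → u≉v
      (≈-from 1ℝ {u - v} {0ℝ} {u} {v} (f 0<N) λ n →
        solve 2 (λ u v → u :- v := con 1ℚ :* ((u :- v) :- con 0ℚ)) refl (seq u n) (seq v n))

  on-U⇒ordinate≈0 : ∀ {P} → P ∈ segment U → ordinate P ≈ 0ℝ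
  on-U⇒ordinate≈0 {P@(x , y)} (t , _ , _ , eq₁ , eq₂) =
    ≈-from₂ d₂ {a₁ + t * d₁} {x} (- d₁) {a₂ + t * d₂} {y} {ordinate P} {0ℝ} eq₁ eq₂ λ n →
      solve 7 (λ d₁ d₂ a₁ a₂ x y t →
        (d₁ :* (y :- a₂) :- d₂ :* (x :- a₁)) :- con 0ℚ
        := d₂ :* ((a₁ :+ t :* d₁) :- x) :+ (:- d₁) :* ((a₂ :+ t :* d₂) :- y))
      refl (seq d₁ n) (seq d₂ n) (seq a₁ n) (seq a₂ n) (seq x n) (seq y n) (seq t n)

  -- The distance from the line through U, signed so that it is positive on
  -- the side in question.
  height : Fin 2 → Point → ℝ
  height zero    P = ordinate P
  height (suc _) P = - ordinate P

  -- Abscissae interpolate as points do, and interpolation from a point of ordinate 0 merely scales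
  -- the ordinate. The two interpolated points thus have equal coordinates.
  crossing⇒meet : ∀ s S S′ {P Q P′ Q′} →
    P ∈ segment S → Q ∈ segment S → P′ ∈ segment S′ → Q′ ∈ segment S′ →
    ordinate P ≈ 0ℝ → ordinate P′ ≈ 0ℝ →
    Crossing (abscissa P) (abscissa Q) (height s Q) (abscissa P′) (abscissa Q′) (height s Q′) →
    segment S ≬ segment S′
  crossing⇒meet s S S′ {P@(x , y)} {Q@(u , v)} {P′@(x′ , y′)} {Q′@(u′ , v′)}
                P∈ Q∈ P′∈ Q′∈ flat flat′ (a , b , a∈ , b∈ , across , up) =
    lerp P Q a , segment-convex S {P} {Q} {a} P∈ Q∈ a∈ ,
    segment-resp S′ {X′} {X} (≈ᵖ-sym {X} {X′} (coordinates-injective {X} {X′} abscissae ordinates))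
      (segment-convex S′ {P′} {Q′} {b} P′∈ Q′∈ b∈)
    where
    X X′ : Point
    X  = lerp P Q a
    X′ = lerp P′ Q′ b

    abscissa-lerp : ∀ P Q a → abscissa (lerp P Q a) ≈ abscissa P + a * (abscissa Q - abscissa P)
    abscissa-lerp P@(x , y) Q@(u , v) a =
      ≈-pointwise {abscissa (lerp P Q a)} {abscissa P + a * (abscissa Q - abscissa P)} λ n →
      solve 9 (λ d₁ d₂ a₁ a₂ x y u v a →
        d₁ :* ((x :+ a :* (u :- x)) :- a₁) :+ d₂ :* ((y :+ a :* (v :- y)) :- a₂)
        := (d₁ :* (x :- a₁) :+ d₂ :* (y :- a₂))
           :+ a :* ((d₁ :* (u :- a₁) :+ d₂ :* (v :- a₂)) :- (d₁ :* (x :- a₁) :+ d₂ :* (y :- a₂))))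
      refl (seq d₁ n) (seq d₂ n) (seq a₁ n) (seq a₂ n) (seq x n) (seq y n) (seq u n) (seq v n) (seq a n)

    ordinate-lerp : ∀ P Q a → ordinate P ≈ 0ℝ → ordinate (lerp P Q a) ≈ a * ordinate Q
    ordinate-lerp P@(x , y) Q@(u , v) a flat =
      ≈-from (1ℝ - a) {ordinate P} {0ℝ} {ordinate (lerp P Q a)} {a * ordinate Q} flat λ n →
      solve 9 (λ d₁ d₂ a₁ a₂ x y u v a →
        (d₁ :* ((y :+ a :* (v :- y)) :- a₂) :- d₂ :* ((x :+ a :* (u :- x)) :- a₁))
        :- a :* (d₁ :* (v :- a₂) :- d₂ :* (u :- a₁))
        := (con 1ℚ :- a) :* ((d₁ :* (y :- a₂) :- d₂ :* (x :- a₁)) :- con 0ℚ))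
      refl (seq d₁ n) (seq d₂ n) (seq a₁ n) (seq a₂ n) (seq x n) (seq y n) (seq u n) (seq v n) (seq a n)

    abscissae : abscissa X ≈ abscissa X′
    abscissae = ≈-trans {abscissa X} {l} {abscissa X′} (abscissa-lerp P Q a)
      (≈-trans {l} {r} {abscissa X′} across (≈-sym {abscissa X′} {r} (abscissa-lerp P′ Q′ b)))
      where
      l r : ℝ
      l = abscissa P + a * (abscissa Q - abscissa P)
      r = abscissa P′ + b * (abscissa Q′ - abscissa P′)

    unsign : ∀ s → a * height s Q ≈ b * height s Q′ → a * ordinate Q ≈ b * ordinate Q′
    unsign zero    eq = eq
    unsign (suc _) eq = ≈-from (- 1ℝ) {a * (- ordinate Q)} {b * (- ordinate Q′)}
      {a * ordinate Q} {b * ordinate Q′} eq λ n →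
      solve 4 (λ a b h h′ → a :* h :- b :* h′ := con (ℚ.- 1ℚ) :* (a :* (:- h) :- b :* (:- h′)))
        refl (seq a n) (seq b n) (seq (ordinate Q) n) (seq (ordinate Q′) n)

    ordinates : ordinate X ≈ ordinate X′
    ordinates = ≈-trans {ordinate X} {a * ordinate Q} {ordinate X′} (ordinate-lerp P Q a flat)
      (≈-trans {a * ordinate Q} {b * ordinate Q′} {ordinate X′} (unsign s up)
        (≈-sym {ordinate X′} {b * ordinate Q′} (ordinate-lerp P′ Q′ b flat′)))

  module Family {I : Set} (S : I → Segment) (stabs : ∀ i → segment U ≬ segment (S i)) where

    -- One chosen common point, as `S i` may overlap `U` along a whole stretch. The order depends on
    -- the choice, but by `separated` disjoint members never share a position.
    foot : I → Point
    foot i = proj₁ (stabs i)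

    position : I → ℝ
    position i = abscissa (foot i)

    _≺_ : I → I → Set
    i ≺ j = position i < position j

    _⋈_ : I → I → Set
    i ⋈ j = segment (S i) ≬ segment (S j)

    ⋈-sym : ∀ {i j} → i ⋈ j → j ⋈ i
    ⋈-sym (P , P∈ , P∈′) = P , P∈′ , P∈

    ≺-trans : ∀ {i j k} → i ≺ j → j ≺ k → i ≺ k
    ≺-trans {i} {j} {k} = <-trans {position i} {position j} {position k}

    ≺-asym : ∀ {i j} → i ≺ j → ¬ (j ≺ i)
    ≺-asym {i} {j} = <-asym {position i} {position j}

    ≺-irrefl : ∀ {i} → ¬ (i ≺ i)
    ≺-irrefl {i} i≺i = ≺-asym {i} {i} i≺i i≺i

    flat : ∀ i → ordinate (foot i) ≈ 0ℝ
    flat i = on-U⇒ordinate≈0 {foot i} (proj₁ (proj₂ (stabs i)))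

    foot∈ : ∀ i → foot i ∈ segment (S i)
    foot∈ i = proj₂ (proj₂ (stabs i))

    separated : ∀ {i j} → ¬ (i ⋈ j) → ¬ (i ≺ j) → ¬ (j ≺ i) → ⊥
    separated {i} {j} disjoint i⊀j j⊀i = disjoint
      (foot j , segment-resp (S i) {foot i} {foot j}
        (coordinates-injective {foot i} {foot j} (≮≯⇒≈ {position i} {position j} i⊀j j⊀i)
          (≈-trans {ordinate (foot i)} {0ℝ} {ordinate (foot j)} (flat i) (≈-sym {ordinate (foot j)} {0ℝ} (flat j))))
        (foot∈ i) , foot∈ j)

    -- The inequality is weak: a common point on the line through `U` counts for both sides.
    Linked : Fin 2 → I → I → Set
    Linked s i j = ∃[ Q ] (Q ∈ segment (S i) × Q ∈ segment (S j) × 0ℝ ≤ height s Q)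

    Linked-sym : ∀ {s i j} → Linked s i j → Linked s j i
    Linked-sym (Q , Q∈ , Q∈′ , h) = Q , Q∈′ , Q∈ , h

    sign : ∀ {A : Set} → Dec A → Fin 2
    sign (yes _) = zero
    sign (no _)  = suc zero

    ⋈⇒Linked : ∀ {i j} (i⋈j : i ⋈ j) (above? : Dec (0ℝ ≤ ordinate (proj₁ i⋈j))) → Linked (sign above?) i j
    ⋈⇒Linked (Q , Q∈ , Q∈′) (yes above) = Q , Q∈ , Q∈′ , above
    ⋈⇒Linked (Q , Q∈ , Q∈′) (no ¬above) = Q , Q∈ , Q∈′ ,
      0≤-resp {0ℝ - ordinate Q} {(- ordinate Q)}
        (≈-pointwise {0ℝ - ordinate Q} {(- ordinate Q)} λ n → ℚP.+-identityˡ (seq (- ordinate Q) n))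
        (≤⇒0≤- {ordinate Q} {0ℝ} (≰⇒≥ {0ℝ} {ordinate Q} ¬above))

    -- The feet of `i` and `k` together with `Q` span the triangle; the path runs inside `S j` from
    -- its foot to `Q′`.
    trapped : ∀ s {i j k Q Q′} → i ≺ j → j ≺ k → ¬ (i ⋈ j) → ¬ (j ⋈ k) →
              Q ∈ segment (S i) → Q ∈ segment (S k) → Q′ ∈ segment (S j) →
              0ℝ ≤ height s Q → ¬ (height s Q ≤ height s Q′)
    trapped s {i} {j} {k} {Q} {Q′} i≺j j≺k ¬ij ¬jk Q∈i Q∈k Q′∈j 0≤h h≤h′ =
      triangle-trap {position i} {position j} {position k} {abscissa Q} {height s Q} {abscissa Q′} {height s Q′}
        i≺j j≺k 0≤h h≤h′
        (λ c → ¬ij (crossing⇒meet s (S i) (S j) {foot i} {Q} {foot j} {Q′}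
          (foot∈ i) Q∈i (foot∈ j) Q′∈j (flat i) (flat j) c))
        (λ c → ¬jk (⋈-sym {k} {j} (crossing⇒meet s (S k) (S j) {foot k} {Q} {foot j} {Q′}
          (foot∈ k) Q∈k (foot∈ j) Q′∈j (flat k) (flat j) c)))

    -- The lower of the two link points serves as apex. If it is `Q`, the path from `j` to `Q′`
    -- would escape the triangle over `i` and `k`; if it is `Q′`, the path from `k` to `Q` would
    -- escape the triangle over `j` and `l`.
    no-interleaving : ∀ s {i j k l} → i ≺ j → j ≺ k → k ≺ l → Linked s i k → Linked s j l →
                      ¬ (i ⋈ j) → ¬ (j ⋈ k) → ¬ (k ⋈ l) → ⊥
    no-interleaving s {i} {j} {k} {l} i≺j j≺k k≺l (Q , Q∈i , Q∈k , 0≤h) (Q′ , Q′∈j , Q′∈l , 0≤h′) ¬ij ¬jk ¬kl =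
      trapped s {i} {j} {k} {Q} {Q′} i≺j j≺k ¬ij ¬jk Q∈i Q∈k Q′∈j 0≤h λ h′<h →
      trapped s {j} {k} {l} {Q′} {Q} j≺k k≺l ¬jk ¬kl Q′∈j Q′∈l Q∈k 0≤h′
        (<⇒≤ {height s Q′} {height s Q} h′<h)

    -- With `l` before `i` or after `k`, the links `i k` and `j l` would interleave; ties are ruled
    -- out by `separated`.
    linked-stays-inside : ∀ s {i j k l} → Linked s i k → Linked s j l →
      ¬ (i ⋈ j) → ¬ (j ⋈ k) → ¬ (i ⋈ l) → ¬ (k ⋈ l) →
      i ≺ j → j ≺ k → ¬ ¬ (i ≺ l × l ≺ k)
    linked-stays-inside s {i} {j} {k} {l} ik jl ¬ij ¬jk ¬il ¬kl i≺j j≺k outside =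
      separated {i} {l} ¬il
        (λ i≺l → separated {l} {k} (λ m → ¬kl (⋈-sym {l} {k} m))
          (λ l≺k → outside (i≺l , l≺k))
          (λ k≺l → no-interleaving s {i} {j} {k} {l} i≺j j≺k k≺l ik jl ¬ij ¬jk ¬kl))
        (λ l≺i → no-interleaving s {l} {i} {j} {k} l≺i i≺j j≺k (Linked-sym {s} {j} {l} jl) ik
          (λ m → ¬il (⋈-sym {l} {i} m)) ¬ij ¬jk)

    -- Two stars of links on the same side of U, with centres c and d, whose
    -- members are otherwise disjoint, do not cross.
    no-abab : ∀ s {w x y z c d} → Linked s c w → Linked s c y → Linked s d x → Linked s d z →
      ¬ (w ⋈ x) → ¬ (w ⋈ z) → ¬ (w ⋈ d) → ¬ (y ⋈ x) → ¬ (y ⋈ z) → ¬ (y ⋈ d) →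
      ¬ (c ⋈ x) → ¬ (c ⋈ z) → ¬ (c ⋈ d) → w ≺ x → x ≺ y → y ≺ z → ⊥
    no-abab s {w} {x} {y} {z} {c} {d} cw cy dx dz ¬wx ¬wz ¬wd ¬yx ¬yz ¬yd ¬cx ¬cz ¬cd w≺x x≺y y≺z =
      -- The position of `c` is unknown. Before `x`, the link `c y` encloses `x`, then `d`, then
      -- `z`, against `y ≺ z`. Between `x` and `z`, the link `w c` encloses the same three, against
      -- `c ≺ z`. After `z`, the link `y c` encloses `z`, then `d`, then `x`, against `x ≺ y`.
      separated {c} {x} ¬cx
        (λ c≺x → inside-x {c} {y} cy ¬cx ¬yx ¬cz ¬yz ¬cd ¬yd c≺x x≺y λ (_ , z≺y) → ≺-asym {y} {z} y≺z z≺y)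
        (λ x≺c → separated {c} {z} ¬cz
          (λ c≺z → inside-x {w} {c} (Linked-sym {s} {c} {w} cw) ¬wx ¬cx ¬wz ¬cz ¬wd ¬cd w≺x x≺c
            λ (_ , z≺c) → ≺-asym {c} {z} c≺z z≺c)
          (λ z≺c → linked-stays-inside s {y} {z} {c} {d} (Linked-sym {s} {c} {y} cy) (Linked-sym {s} {d} {z} dz)
            ¬yz (λ m → ¬cz (⋈-sym {z} {c} m)) ¬yd ¬cd y≺z z≺c λ (y≺d , d≺c) →
            linked-stays-inside s {y} {d} {c} {x} (Linked-sym {s} {c} {y} cy) dx
            ¬yd (λ m → ¬cd (⋈-sym {d} {c} m)) ¬yx ¬cx y≺d d≺c λ (y≺x , _) → ≺-asym {x} {y} x≺y y≺x))
      where
      inside-x : ∀ {u v} → Linked s u v → ¬ (u ⋈ x) → ¬ (v ⋈ x) → ¬ (u ⋈ z) → ¬ (v ⋈ z) →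
                 ¬ (u ⋈ d) → ¬ (v ⋈ d) → u ≺ x → x ≺ v → ¬ ¬ (u ≺ z × z ≺ v)
      inside-x {u} {v} uv ¬ux ¬vx ¬uz ¬vz ¬ud ¬vd u≺x x≺v k =
        linked-stays-inside s {u} {x} {v} {d} uv (Linked-sym {s} {d} {x} dx)
          ¬ux (λ m → ¬vx (⋈-sym {x} {v} m)) ¬ud ¬vd u≺x x≺v λ (u≺d , d≺v) →
        linked-stays-inside s {u} {d} {v} {z} uv dz
          ¬ud (λ m → ¬vd (⋈-sym {d} {v} m)) ¬uz ¬vz u≺d d≺v k

-- Sequences without alternation

-- Within a class the changes of either label follow a Davenport-Schinzel sequence of order 2, so
-- there are linearly many of them. The proof is by charging: every `x` receives a token of its own,
-- made of a class, a label function, a label and one of two ends.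
module Counting
  {n q m : ℕ} {_≺_ : Rel (Fin n) 0ℓ} (isSTO : IsStrictTotalOrder _≡_ _≺_)
  (class : Fin n → Fin q) (label : Fin 2 → Fin n → Fin m)
  (separates : ∀ x y → (∀ b → label b x ≡ label b y) → x ≡ y)
  (no-abab : ∀ b w x y z → w ≺ x → x ≺ y → y ≺ z →
             class x ≡ class w → class y ≡ class w → class z ≡ class w →
             label b w ≡ label b y → label b x ≡ label b z → label b w ≢ label b x → ⊥)
  where

  open IsStrictTotalOrder isSTO using (compare; irrefl; asym; _<?_; isStrictPartialOrder)
    renaming (trans to ≺-trans)

  -- Descends along `_≺_`, which is well founded because `Fin n` is finite.
  least : ∀ {P : Pred (Fin n) 0ℓ} → Decidable P → ∃ P → ∃[ y ] (P y × ∀ z → P z → ¬ (z ≺ y))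
  least {P} P? (x , px) = go x px (spo-wellFounded isStrictPartialOrder x)
    where
    go : ∀ x → P x → Acc _≺_ x → ∃[ y ] (P y × ∀ z → P z → ¬ (z ≺ y))
    go x px (acc rec) with FinP.any? (λ z → P? z ×-dec (z <? x))
    ... | yes (z , pz , z≺x) = go z pz (rec z≺x)
    ... | no ∄z = x , px , λ z pz z≺x → ∄z (z , pz , z≺x)

  Later : Fin n → Fin n → Set
  Later x y = class y ≡ class x × x ≺ y

  later? : ∀ x y → Dec (Later x y)
  later? x y = (class y FinP.≟ class x) ×-dec (x <? y)

  Next : Fin n → Fin n → Set
  Next x y = Later x y × ∀ z → Later x z → ¬ (z ≺ y)

  -- The end `zero` stands for the last occurrence of `l` in the class, the other end for the first
  -- occurrence `y`. The latter is owned by the predecessor of `y`, since the change from `x` to `y`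
  -- is charged to `x`.
  data Owns (x : Fin n) (c : Fin q) (b : Fin 2) (l : Fin m) : Fin 2 → Set where
    final   : class x ≡ c → label b x ≡ l →
              (∀ z → Later x z → label b z ≢ l) → Owns x c b l zero
    initial : ∀ y → class x ≡ c → Next x y → label b y ≡ l →
              (∀ z → Later z y → label b z ≢ l) → Owns x c b l (suc zero)

  -- A label has one last and one first occurrence in a class, and the first has at most one
  -- immediate predecessor there.
  owner-unique : ∀ {x x′ c b l e} → Owns x c b l e → Owns x′ c b l e → x ≡ x′
  owner-unique {x} {x′} (final refl refl fin) (final c≡ l≡ fin′) with compare x x′
  ... | tri< x≺x′ _ _ = ⊥-elim (fin x′ (c≡ , x≺x′) l≡)
  ... | tri≈ _ x≡x′ _ = x≡x′
  ... | tri> _ _ x′≺x = ⊥-elim (fin′ x (sym c≡ , x′≺x) refl)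
  owner-unique {x} {x′} (initial y refl ((cy , x≺y) , nx) refl ini)
                        (initial y′ c≡ ((cy′ , x′≺y′) , nx′) l≡ ini′) with compare y y′
  ... | tri< y≺y′ _ _ = ⊥-elim (ini′ y (trans cy′ (trans c≡ (sym cy)) , y≺y′) refl)
  ... | tri> _ _ y′≺y = ⊥-elim (ini y′ (trans cy (sym (trans cy′ c≡)) , y′≺y) l≡)
  ... | tri≈ _ refl _ with compare x x′
  ...   | tri< x≺x′ _ _ = ⊥-elim (nx x′ (c≡ , x≺x′) x′≺y′)
  ...   | tri≈ _ x≡x′ _ = x≡x′
  ...   | tri> _ _ x′≺x = ⊥-elim (nx′ x (sym c≡ , x′≺x) x≺y)

  Token : Fin n → Set
  Token x = ∃[ c ] ∃[ b ] ∃[ l ] ∃[ e ] Owns x c b l e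

  -- Otherwise x and y, an earlier occurrence of the label of y and a later one of
  -- the label of x alternate.
  token-at-change : ∀ x y b → Next x y → label b x ≢ label b y → Token x
  token-at-change x y b nx@((cy , x≺y) , least-y) x≢y
    with FinP.any? (λ z → later? x z ×-dec (label b z FinP.≟ label b x))
  ... | no ∄z = _ , b , _ , _ , final refl refl λ z x≺z z≡x → ∄z (z , x≺z , z≡x)
  ... | yes (z , (cz , x≺z) , z≡x) = _ , b , _ , _ , initial y refl nx refl first
    where
    y≺z : y ≺ z
    y≺z with compare y z
    ... | tri< y≺z _ _ = y≺z
    ... | tri≈ _ refl _ = ⊥-elim (x≢y (sym z≡x))
    ... | tri> _ _ z≺y = ⊥-elim (least-y z (cz , x≺z) z≺y)

    first : ∀ w → Later w y → label b w ≢ label b y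
    first w (cw , w≺y) w≡y with compare w x
    ... | tri≈ _ refl _ = x≢y w≡y
    ... | tri> _ _ x≺w = least-y w (trans (sym cw) cy , x≺w) w≺y
    ... | tri< w≺x _ _ = no-abab b w x y z w≺x x≺y y≺z
      (trans (sym cy) cw) cw (trans cz (trans (sym cy) cw))
      w≡y (sym z≡x) λ w≡x → x≢y (trans (sym w≡x) w≡y)

  token : ∀ x → Token x
  token x with FinP.any? (later? x)
  -- The last member of a class owns the final token of its label for either `b`; `zero` is an
  -- arbitrary choice.
  ... | no ∄y = _ , zero , _ , _ , final refl refl λ z x≺z _ → ∄y (z , x≺z)
  ... | yes ∃y with least (later? x) ∃y
  ...   | y , nx with label zero x FinP.≟ label zero y | label (suc zero) x FinP.≟ label (suc zero) y
  ...     | no x≢y | _      = token-at-change x y zero nx x≢y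
  ...     | yes _  | no x≢y = token-at-change x y (suc zero) nx x≢y
  ...     | yes p  | yes q  = ⊥-elim (irrefl (separates x y both) (proj₂ (proj₁ nx)))
    where
    both : ∀ b → label b x ≡ label b y
    both zero       = p
    both (suc zero) = q

  code : Fin n → Fin (q ℕ.* (2 ℕ.* (m ℕ.* 2)))
  code x = let c , b , l , e , _ = token x in combine c (combine b (combine l e))

  code-injective : ∀ {x y} → code x ≡ code y → x ≡ y
  code-injective {x} {y} eq with token x | token y
  ... | c , b , l , e , own | c′ , b′ , l′ , e′ , own′
    with FinP.combine-injective c _ c′ _ eq
  ... | refl , eq₁ with FinP.combine-injective b _ b′ _ eq₁
  ... | refl , eq₂ with FinP.combine-injective l e l′ e′ eq₂
  ... | refl , refl = owner-unique own own′

  bound : n ℕ.≤ q ℕ.* (2 ℕ.* (m ℕ.* 2))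
  bound = FinP.injective⇒≤ code-injective

-- Rectangles

0<constant : ∀ {x q} → 0ℚ ℚ.< q → (∀ n → seq x n ≡ q) → 0ℝ < x
0<constant {x} {q} 0<q eq = bound⇒0< {x} (0<½* 0<q) (0 , λ n _ → subst (½ ℚ.* q ℚ.<_) (sym (eq n)) ½q<q)
  where
  ½q<q : ½ ℚ.* q ℚ.< q
  ½q<q = subst₂ ℚ._<_ (ℚP.+-identityʳ _) (halves q) (ℚP.+-monoʳ-< (½ ℚ.* q) (0<½* 0<q))

0≤fromℚ : ∀ {q} → 0ℚ ℚ.≤ q → 0ℝ ≤ fromℚ q
0≤fromℚ {q} 0≤q (ε , 0<ε , ev) =
  ℚP.<-irrefl refl (ℚP.<-trans (ℚP.+-mono-≤-< 0≤q 0<ε) (proj₂ (eventually⇒∃ ev)))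

0<ℚ- : ∀ {p q} → p ℚ.< q → 0ℚ ℚ.< q ℚ.- p
0<ℚ- {p} {q} p<q = subst (ℚ._< q ℚ.- p) (ℚP.+-inverseʳ p) (ℚP.+-monoˡ-< (ℚ.- p) p<q)

0≤ℚ- : ∀ {p q} → p ℚ.≤ q → 0ℚ ℚ.≤ q ℚ.- p
0≤ℚ- {p} {q} p≤q = subst (ℚ._≤ q ℚ.- p) (ℚP.+-inverseʳ p) (ℚP.+-monoˡ-≤ (ℚ.- p) p≤q)

0≤*ℚ : ∀ {p q} → 0ℚ ℚ.≤ p → 0ℚ ℚ.≤ q → 0ℚ ℚ.≤ p ℚ.* q
0≤*ℚ {p} {q} 0≤p 0≤q =
  subst (ℚ._≤ p ℚ.* q) (ℚP.*-zeroʳ p) (ℚP.*-monoˡ-≤-nonNeg p {{ℚ.nonNegative 0≤p}} 0≤q)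

interpolate : ∀ {a b x} → a ℚ.< b → a ℚ.≤ x → x ℚ.≤ b →
              ∃[ s ] (0ℚ ℚ.≤ s × 0ℚ ℚ.≤ 1ℚ ℚ.- s × a ℚ.+ s ℚ.* (b ℚ.- a) ≡ x)
interpolate {a} {b} {x} a<b a≤x x≤b =
  let I , 0<I , wI≡1 = inverseℚ (b ℚ.- a) (0<ℚ- a<b)
      s = (x ℚ.- a) ℚ.* I
      unscale = λ y → trans
        (solve 3 (λ y w I → (y :* I) :* w := y :* (w :* I)) refl y (b ℚ.- a) I)
        (trans (cong (y ℚ.*_) wI≡1) (ℚP.*-identityʳ y))
  in s , 0≤*ℚ (0≤ℚ- a≤x) (ℚP.<⇒≤ 0<I)
   , subst (0ℚ ℚ.≤_)
       (trans (solve 4 (λ a b x I → (b :- x) :* I := (b :- a) :* I :- (x :- a) :* I) refl a b x I)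
              (cong (ℚ._- s) wI≡1))
       (0≤*ℚ (0≤ℚ- x≤b) (ℚP.<⇒≤ 0<I))
   , trans (cong (a ℚ.+_) (unscale (x ℚ.- a))) (solve 2 (λ a x → a :+ (x :- a) := x) refl a x)

cornerX cornerY : ℚ → ℚ → Fin 4 → ℚ
cornerX a b 0F = a
cornerX a b 1F = b
cornerX a b 2F = b
cornerX a b 3F = a
cornerY c d 0F = c
cornerY c d 1F = c
cornerY c d 2F = d
cornerY c d 3F = d

cornerX-within : ∀ {a b} → a ℚ.< b → ∀ i → a ℚ.≤ cornerX a b i × cornerX a b i ℚ.≤ b
cornerX-within a<b 0F = ℚP.≤-refl , ℚP.<⇒≤ a<b
cornerX-within a<b 1F = ℚP.<⇒≤ a<b , ℚP.≤-refl
cornerX-within a<b 2F = ℚP.<⇒≤ a<b , ℚP.≤-refl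
cornerX-within a<b 3F = ℚP.≤-refl , ℚP.<⇒≤ a<b

cornerY-within : ∀ {c d} → c ℚ.< d → ∀ i → c ℚ.≤ cornerY c d i × cornerY c d i ℚ.≤ d
cornerY-within c<d 0F = ℚP.≤-refl , ℚP.<⇒≤ c<d
cornerY-within c<d 1F = ℚP.≤-refl , ℚP.<⇒≤ c<d
cornerY-within c<d 2F = ℚP.<⇒≤ c<d , ℚP.≤-refl
cornerY-within c<d 3F = ℚP.<⇒≤ c<d , ℚP.≤-refl

module _ {a b c d : ℚ} (a<b : a ℚ.< b) (c<d : c ℚ.< d) where

  corner : Vector Point 4
  corner i = fromℚ (cornerX a b i) , fromℚ (cornerY c d i)

  private
    positive-area : ∀ {x} → (∀ n → seq x n ≡ (b ℚ.- a) ℚ.* (d ℚ.- c)) → 0ℝ < x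
    positive-area {x} = 0<constant {x} (0<*ℚ (0<ℚ- a<b) (0<ℚ- c<d))

  box : Polygon
  box = record { extra = 1 ; vertex = corner ; convex = convex }
    where
    area : ∀ i j k → ℝ
    area i j k = det (corner j -ᵖ corner i) (corner k -ᵖ corner i)

    next : Fin 4 → Fin 4
    next i = suc (toℕ i) mod 4

    -- All eight determinants equal the area `(b - a) * (d - c)`.
    convex : ∀ i j → j ≢ i → j ≢ next i → StrictlyLeftOf (corner i) (corner (next i)) (corner j)
    convex 0F 0F ≢0 ≢1 = ⊥-elim (≢0 refl)
    convex 0F 1F ≢0 ≢1 = ⊥-elim (≢1 refl)
    convex 0F 2F ≢0 ≢1 = positive-area {area 0F 1F 2F} λ n → solve 4 (λ a b c d →
      (b :- a) :* (d :- c) :- (c :- c) :* (b :- a) := (b :- a) :* (d :- c)) refl a b c d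
    convex 0F 3F ≢0 ≢1 = positive-area {area 0F 1F 3F} λ n → solve 4 (λ a b c d →
      (b :- a) :* (d :- c) :- (c :- c) :* (a :- a) := (b :- a) :* (d :- c)) refl a b c d
    convex 1F 0F ≢1 ≢2 = positive-area {area 1F 2F 0F} λ n → solve 4 (λ a b c d →
      (b :- b) :* (c :- c) :- (d :- c) :* (a :- b) := (b :- a) :* (d :- c)) refl a b c d
    convex 1F 1F ≢1 ≢2 = ⊥-elim (≢1 refl)
    convex 1F 2F ≢1 ≢2 = ⊥-elim (≢2 refl)
    convex 1F 3F ≢1 ≢2 = positive-area {area 1F 2F 3F} λ n → solve 4 (λ a b c d →
      (b :- b) :* (d :- c) :- (d :- c) :* (a :- b) := (b :- a) :* (d :- c)) refl a b c d
    convex 2F 0F ≢2 ≢3 = positive-area {area 2F 3F 0F} λ n → solve 4 (λ a b c d →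
      (a :- b) :* (c :- d) :- (d :- d) :* (a :- b) := (b :- a) :* (d :- c)) refl a b c d
    convex 2F 1F ≢2 ≢3 = positive-area {area 2F 3F 1F} λ n → solve 4 (λ a b c d →
      (a :- b) :* (c :- d) :- (d :- d) :* (b :- b) := (b :- a) :* (d :- c)) refl a b c d
    convex 2F 2F ≢2 ≢3 = ⊥-elim (≢2 refl)
    convex 2F 3F ≢2 ≢3 = ⊥-elim (≢3 refl)
    convex 3F 0F ≢3 ≢0 = ⊥-elim (≢0 refl)
    convex 3F 1F ≢3 ≢0 = positive-area {area 3F 0F 1F} λ n → solve 4 (λ a b c d →
      (a :- a) :* (c :- d) :- (c :- d) :* (b :- a) := (b :- a) :* (d :- c)) refl a b c d
    convex 3F 2F ≢3 ≢0 = positive-area {area 3F 0F 2F} λ n → solve 4 (λ a b c d →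
      (a :- a) :* (d :- d) :- (c :- d) :* (b :- a) := (b :- a) :* (d :- c)) refl a b c d
    convex 3F 3F ≢3 ≢0 = ⊥-elim (≢3 refl)

  ∈-box : ∀ {x y} → a ℚ.≤ x → x ℚ.≤ b → c ℚ.≤ y → y ℚ.≤ d → (fromℚ x , fromℚ y) ∈ polygon box
  ∈-box {x} {y} a≤x x≤b c≤y y≤d =
    let s , 0≤s , 0≤1-s , eqx = interpolate a<b a≤x x≤b
        t , 0≤t , 0≤1-t , eqy = interpolate c<d c≤y y≤d
    in bilinear s t 0≤s 0≤1-s 0≤t 0≤1-t eqx eqy
    where
    bilinear : ∀ s t → 0ℚ ℚ.≤ s → 0ℚ ℚ.≤ 1ℚ ℚ.- s → 0ℚ ℚ.≤ t → 0ℚ ℚ.≤ 1ℚ ℚ.- t →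
               a ℚ.+ s ℚ.* (b ℚ.- a) ≡ x → c ℚ.+ t ℚ.* (d ℚ.- c) ≡ y → (fromℚ x , fromℚ y) ∈ polygon box
    bilinear s t 0≤s 0≤1-s 0≤t 0≤1-t eqx eqy =
      (λ i → fromℚ (weight i)) , (λ i → 0≤fromℚ (0≤weight i))
      , ≈-pointwise {sum λ i → fromℚ (weight i)} {1ℝ} (λ _ → solve 2 (λ s t →
          (con 1ℚ :- s) :* (con 1ℚ :- t) :+ (s :* (con 1ℚ :- t) :+ (s :* t :+ ((con 1ℚ :- s) :* t :+ con 0ℚ)))
          := con 1ℚ) refl s t)
      , ≈-pointwise {sum λ i → fromℚ (weight i) * fromℚ (cornerX a b i)} {fromℚ x} (λ _ → trans (solve 4 (λ s t a b →
          (con 1ℚ :- s) :* (con 1ℚ :- t) :* a :+ (s :* (con 1ℚ :- t) :* b :+ (s :* t :* b :+ ((con 1ℚ :- s) :* t :* a :+ con 0ℚ)))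
          := a :+ s :* (b :- a)) refl s t a b) eqx)
      , ≈-pointwise {sum λ i → fromℚ (weight i) * fromℚ (cornerY c d i)} {fromℚ y} (λ _ → trans (solve 4 (λ s t c d →
          (con 1ℚ :- s) :* (con 1ℚ :- t) :* c :+ (s :* (con 1ℚ :- t) :* c :+ (s :* t :* d :+ ((con 1ℚ :- s) :* t :* d :+ con 0ℚ)))
          := c :+ t :* (d :- c)) refl s t c d) eqy)
      where
      -- Products of the weights for the two coordinates: summing out one coordinate leaves the
      -- interpolation in the other.
      weight : Fin 4 → ℚ
      weight 0F = (1ℚ ℚ.- s) ℚ.* (1ℚ ℚ.- t)
      weight 1F = s ℚ.* (1ℚ ℚ.- t)
      weight 2F = s ℚ.* t
      weight 3F = (1ℚ ℚ.- s) ℚ.* t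

      0≤weight : ∀ i → 0ℚ ℚ.≤ weight i
      0≤weight 0F = 0≤*ℚ 0≤1-s 0≤1-t
      0≤weight 1F = 0≤*ℚ 0≤s 0≤1-t
      0≤weight 2F = 0≤*ℚ 0≤s 0≤t
      0≤weight 3F = 0≤*ℚ 0≤1-s 0≤t

0≤-sum : ∀ {n} (x : Vector ℝ n) → (∀ i → 0ℝ ≤ x i) → 0ℝ ≤ sum x
0≤-sum {0}     x 0≤x = ≈⇒≤ {0ℝ} {0ℝ} (≈-refl {0ℝ})
0≤-sum {suc _} x 0≤x = 0≤-+ {x zero} {sum λ i → x (suc i)} (0≤x zero) (0≤-sum (λ i → x (suc i)) λ i → 0≤x (suc i))

-- The weights of a hull sum to 1 only up to `_≈_`. Keeping their total in the formula makes it an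
-- exact identity at every index `l` of the sequences.
sum-affine : ∀ {n} k m (v : Vector ℚ n) (w : Vector ℝ n) l →
  seq (sum λ i → w i * fromℚ (k ℚ.* (v i ℚ.- m))) l
  ≡ k ℚ.* (seq (sum λ i → w i * fromℚ (v i)) l ℚ.- m ℚ.* seq (sum w) l)
sum-affine {0}     k m v w l = solve 2 (λ k m → con 0ℚ := k :* (con 0ℚ :- m :* con 0ℚ)) refl k m
sum-affine {suc _} k m v w l = trans
  (cong (seq (w zero) l ℚ.* (k ℚ.* (v zero ℚ.- m)) ℚ.+_) (sum-affine k m (λ i → v (suc i)) (λ i → w (suc i)) l))
  (solve 6 (λ k m v w s t → w :* (k :* (v :- m)) :+ k :* (s :- m :* t) := k :* ((w :* v :+ s) :- m :* (w :+ t)))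
    refl k m (v zero) (seq (w zero) l)
    (seq (sum λ i → w (suc i) * fromℚ (v (suc i))) l) (seq (sum λ i → w (suc i)) l))

-- An affine function that is nonnegative at the corners is nonnegative on their hull. The sign of
-- `k` selects the side of the line at `m`.
hull-halfplane : ∀ {n} k m (v : Vector ℚ n) (w : Vector ℝ n) (x : ℝ) →
  (∀ i → 0ℚ ℚ.≤ k ℚ.* (v i ℚ.- m)) → (∀ i → 0ℝ ≤ w i) → sum w ≈ 1ℝ →
  sum (λ i → w i * fromℚ (v i)) ≈ x → 0ℝ ≤ fromℚ k * (x - fromℚ m)
hull-halfplane k m v w x corners 0≤w total eq =
  0≤-resp {sum λ i → w i * fromℚ (k ℚ.* (v i ℚ.- m))} {fromℚ k * (x - fromℚ m)}
    (≈-from₂ (fromℚ k) {s} {x} (fromℚ (ℚ.- (k ℚ.* m))) {sum w} {1ℝ}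
      {sum λ i → w i * fromℚ (k ℚ.* (v i ℚ.- m))} {fromℚ k * (x - fromℚ m)} eq total λ n →
      trans (cong (ℚ._- k ℚ.* (seq x n ℚ.- m)) (sum-affine k m v w n))
        (solve 5 (λ k m s t x → k :* (s :- m :* t) :- k :* (x :- m)
                             := k :* (s :- x) :+ (:- (k :* m)) :* (t :- con 1ℚ))
          refl k m (seq s n) (seq (sum w) n) (seq x n)))
    (0≤-sum _ λ i → 0≤-* {w i} {fromℚ (k ℚ.* (v i ℚ.- m))} (0≤w i) (0≤fromℚ (corners i)))
  where
  s : ℝ
  s = sum λ i → w i * fromℚ (v i)

-- At a common point both `b - x` and `x - a′` would be nonnegative, but their sum is `b - a′`,
-- which is negative.
separated-hulls : ∀ {b a′ : ℚ} (v v′ : Fin 4 → ℚ) (w w′ : Fin 4 → ℝ) (x : ℝ) → b ℚ.< a′ →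
  (∀ i → v i ℚ.≤ b) → (∀ i → a′ ℚ.≤ v′ i) →
  (∀ i → 0ℝ ≤ w i) → sum w ≈ 1ℝ → sum (λ i → w i * fromℚ (v i)) ≈ x →
  (∀ i → 0ℝ ≤ w′ i) → sum w′ ≈ 1ℝ → sum (λ i → w′ i * fromℚ (v′ i)) ≈ x → ⊥
separated-hulls {b} {a′} v v′ w w′ x b<a′ v≤b a′≤v′ 0≤w total eq 0≤w′ total′ eq′ =
  0≤-+ {fromℚ (ℚ.- 1ℚ) * (x - fromℚ b)} {1ℝ * (x - fromℚ a′)}
    (hull-halfplane (ℚ.- 1ℚ) b v w x
      (λ i → subst (0ℚ ℚ.≤_) (solve 2 (λ v b → b :- v := con (ℚ.- 1ℚ) :* (v :- b)) refl (v i) b) (0≤ℚ- (v≤b i)))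
      0≤w total eq)
    (hull-halfplane 1ℚ a′ v′ w′ x
      (λ i → subst (0ℚ ℚ.≤_) (sym (ℚP.*-identityˡ _)) (0≤ℚ- (a′≤v′ i)))
      0≤w′ total′ eq′)
    (0<-⇒<0 {s} (0<constant {(- s)} (0<ℚ- b<a′) λ n →
      solve 3 (λ x b a → :- (con (ℚ.- 1ℚ) :* (x :- b) :+ con 1ℚ :* (x :- a)) := a :- b) refl (seq x n) b a′))
  where
  s : ℝ
  s = fromℚ (ℚ.- 1ℚ) * (x - fromℚ b) + 1ℝ * (x - fromℚ a′)

module _ {a b c d a′ b′ c′ d′ : ℚ} (a<b : a ℚ.< b) (c<d : c ℚ.< d) (a′<b′ : a′ ℚ.< b′) (c′<d′ : c′ ℚ.< d′) where

  separated-x : b ℚ.< a′ → ¬ (polygon (box a<b c<d) ≬ polygon (box a′<b′ c′<d′))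
  separated-x b<a′ (p , (w , 0≤w , total , eq , _) , (w′ , 0≤w′ , total′ , eq′ , _)) =
    separated-hulls (cornerX a b) (cornerX a′ b′) w w′ (proj₁ p) b<a′
      (λ i → proj₂ (cornerX-within a<b i)) (λ i → proj₁ (cornerX-within a′<b′ i)) 0≤w total eq 0≤w′ total′ eq′

  separated-y : d ℚ.< c′ → ¬ (polygon (box a<b c<d) ≬ polygon (box a′<b′ c′<d′))
  separated-y d<c′ (p , (w , 0≤w , total , _ , eq) , (w′ , 0≤w′ , total′ , _ , eq′)) =
    separated-hulls (cornerY c d) (cornerY c′ d′) w w′ (proj₂ p) d<c′
      (λ i → proj₂ (cornerY-within c<d i)) (λ i → proj₁ (cornerY-within c′<d′ i)) 0≤w total eq 0≤w′ total′ eq′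

-- The grid graph

fromℚ-injective : ∀ {p q} → fromℚ p ≈ fromℚ q → p ≡ q
fromℚ-injective {p} {q} p≈q with ℚP.<-cmp p q
... | tri≈ _ p≡q _ = p≡q
... | tri< p<q _ _ = ⊥-elim (<-irrefl {fromℚ p} {fromℚ q} p≈q
  (0<-⇒< {fromℚ p} {fromℚ q} {fromℚ (q ℚ.- p)} (0<constant {fromℚ (q ℚ.- p)} (0<ℚ- p<q) λ _ → refl) λ _ → refl))
... | tri> _ _ q<p = ⊥-elim (<-irrefl {fromℚ q} {fromℚ p} (≈-sym {fromℚ p} {fromℚ q} p≈q)
  (0<-⇒< {fromℚ q} {fromℚ p} {fromℚ (p ℚ.- q)} (0<constant {fromℚ (p ℚ.- q)} (0<ℚ- q<p) λ _ → refl) λ _ → refl))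

fromℕ : ℕ → ℚ
fromℕ n = fromℤ (+ n)

fromℕ-mono-< : ∀ {m n} → m ℕ.< n → fromℕ m ℚ.< fromℕ n
fromℕ-mono-< {m} {n} m<n =
  ℚ.*<* (subst₂ ℤ._<_ (sym (ℤP.*-identityʳ (+ m))) (sym (ℤP.*-identityʳ (+ n))) (ℤ.+<+ m<n))

fromℕ-mono-≤ : ∀ {m n} → m ℕ.≤ n → fromℕ m ℚ.≤ fromℕ n
fromℕ-mono-≤ {m} {n} m≤n =
  ℚ.*≤* (subst₂ ℤ._≤_ (sym (ℤP.*-identityʳ (+ m))) (sym (ℤP.*-identityʳ (+ n))) (ℤ.+≤+ m≤n))

fromℕ-injective : ∀ {m n} → fromℕ m ≡ fromℕ n → m ≡ n
fromℕ-injective {m} {n} eq = ℤP.+-injective (cong ℚ.numerator eq)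

-- Pairwise distinct directions that include both axes

lineAlong : (u v : ℚ) → ¬ (u ≡ 0ℚ × v ≡ 0ℚ) → LineThroughOrigin
lineAlong u v ≢0 = record
  { direction = fromℚ u , fromℚ v
  ; nonzero   = λ (u≈0 , v≈0) → ≢0 (fromℚ-injective u≈0 , fromℚ-injective v≈0)
  }

1≢0 : 1ℚ ≢ 0ℚ
1≢0 ()

-- The vectors (1, 0), (0, 1), (1, 1), (2, 1), and so on. The first two are the directions of the
-- sides of a `box`; the others only bring the number of lines up to the required one.
slope : ∀ {k} → Fin (suc k) → ℚ × ℚ
slope zero    = 1ℚ , 0ℚ
slope (suc i) = fromℕ (toℕ i) , 1ℚ

slope≢0 : ∀ {k} (i : Fin (suc k)) → ¬ (proj₁ (slope i) ≡ 0ℚ × proj₂ (slope i) ≡ 0ℚ)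
slope≢0 zero    (1≡0 , _) = 1≢0 1≡0
slope≢0 (suc i) (_ , 1≡0) = 1≢0 1≡0

slopes : ∀ k → Fin (suc k) → LineThroughOrigin
slopes k i = lineAlong (proj₁ (slope i)) (proj₂ (slope i)) (slope≢0 i)

cross : ℚ × ℚ → ℚ × ℚ → ℚ
cross (u , v) (u′ , v′) = u ℚ.* v′ ℚ.- v ℚ.* u′

slopes-independent : ∀ {k} (i j : Fin (suc k)) → cross (slope i) (slope j) ≡ 0ℚ → i ≡ j
slopes-independent zero    zero    _  = refl
slopes-independent zero    (suc j) eq = ⊥-elim (1≢0 (trans
  (solve 1 (λ m → con 1ℚ := con 1ℚ :* con 1ℚ :- con 0ℚ :* m) refl (fromℕ (toℕ j))) eq))
slopes-independent (suc i) zero    eq = ⊥-elim (1≢0 (trans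
  (solve 1 (λ m → con 1ℚ := :- (m :* con 0ℚ :- con 1ℚ :* con 1ℚ)) refl (fromℕ (toℕ i))) (cong ℚ.-_ eq)))
slopes-independent (suc i) (suc j) eq = cong suc (FinP.toℕ-injective (fromℕ-injective (trans
  (solve 2 (λ m n → m := (m :* con 1ℚ :- con 1ℚ :* n) :+ n) refl (fromℕ (toℕ i)) (fromℕ (toℕ j)))
  (trans (cong (ℚ._+ fromℕ (toℕ j)) eq) (ℚP.+-identityˡ (fromℕ (toℕ j)))))))

directions : ∀ k → Directions (suc k)
directions k = record { lines = slopes k ; distinct = λ i j i≢j (i⊆j , _) → i≢j (parallel i j (i⊆j {dir i} (self i))) }
  where
  dir : Fin (suc k) → Point
  dir i = LineThroughOrigin.direction (slopes k i)

  self : ∀ i → dir i ∈ line (slopes k i)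
  self i = 1ℝ , ≈-pointwise {1ℝ * proj₁ (dir i)} {proj₁ (dir i)} (λ _ → ℚP.*-identityˡ (proj₁ (slope i)))
              , ≈-pointwise {1ℝ * proj₂ (dir i)} {proj₂ (dir i)} (λ _ → ℚP.*-identityˡ (proj₂ (slope i)))

  parallel : ∀ i j → dir i ∈ line (slopes k j) → i ≡ j
  parallel i j (t , eqx , eqy) = slopes-independent i j (fromℚ-injective
    (≈-from₂ (- v′) {t * u′} {u} u′ {t * v′} {v} {fromℚ (cross (slope i) (slope j))} {0ℝ} eqx eqy λ n →
      solve 5 (λ u v u′ v′ t → (u :* v′ :- v :* u′) :- con 0ℚ
          := (:- v′) :* (t :* u′ :- u) :+ u′ :* (t :* v′ :- v))
        refl (proj₁ (slope i)) (proj₂ (slope i)) (proj₁ (slope j)) (proj₂ (slope j)) (seq t n)))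
    where
    u v u′ v′ : ℝ
    u = proj₁ (dir i)
    v = proj₂ (dir i)
    u′ = proj₁ (dir j)
    v′ = proj₂ (dir j)

box∈𝒫 : ∀ {k a b c d} (a<b : a ℚ.< b) (c<d : c ℚ.< d) → box a<b c<d ∈ 𝒫 (directions (suc k))
box∈𝒫 {k} {a} {b} {c} {d} a<b c<d = sides
  where
  P = box a<b c<d

  horizontal : ∀ i e s → (∀ n → seq (proj₁ (Polygon.side P i)) n ≡ e) → (∀ n → seq (proj₂ (Polygon.side P i)) n ≡ s ℚ.- s) →
               Polygon.side P i ∥ slopes (suc k) zero
  horizontal i e s eqx eqy = fromℚ e
    , ≈-pointwise {fromℚ e * 1ℝ} {proj₁ (Polygon.side P i)} (λ n → trans (ℚP.*-identityʳ e) (sym (eqx n)))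
    , ≈-pointwise {fromℚ e * 0ℝ} {proj₂ (Polygon.side P i)} (λ n → trans (ℚP.*-zeroʳ e) (sym (trans (eqy n) (ℚP.+-inverseʳ s))))

  vertical : ∀ i e s → (∀ n → seq (proj₁ (Polygon.side P i)) n ≡ s ℚ.- s) → (∀ n → seq (proj₂ (Polygon.side P i)) n ≡ e) →
             Polygon.side P i ∥ slopes (suc k) (suc zero)
  vertical i e s eqx eqy = fromℚ e
    , ≈-pointwise {fromℚ e * 0ℝ} {proj₁ (Polygon.side P i)} (λ n → trans (ℚP.*-zeroʳ e) (sym (trans (eqx n) (ℚP.+-inverseʳ s))))
    , ≈-pointwise {fromℚ e * 1ℝ} {proj₂ (Polygon.side P i)} (λ n → trans (ℚP.*-identityʳ e) (sym (eqy n)))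

  sides : ∀ i → ∃[ j ] Polygon.side P i ∥ slopes (suc k) j
  sides 0F = zero , horizontal 0F (b ℚ.- a) c (λ _ → refl) (λ _ → refl)
  sides 1F = suc zero , vertical 1F (d ℚ.- c) b (λ _ → refl) (λ _ → refl)
  sides 2F = zero , horizontal 2F (a ℚ.- b) d (λ _ → refl) (λ _ → refl)
  sides 3F = suc zero , vertical 3F (c ℚ.- d) a (λ _ → refl) (λ _ → refl)

module Grid (N : ℕ) where

  -- Index zero is an interval that contains N pairwise disjoint ones.
  lower upper : Fin (suc N) → ℕ
  lower zero    = 0
  lower (suc k) = toℕ k ℕ.+ toℕ k
  upper zero    = suc (N ℕ.+ N)
  upper (suc k) = suc (toℕ k ℕ.+ toℕ k)

  lower<upper : ∀ a → lower a ℕ.< upper a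
  lower<upper zero    = s≤s z≤n
  lower<upper (suc k) = ℕP.n<1+n _

  lower≤upper-zero : ∀ a → lower a ℕ.≤ upper zero
  lower≤upper-zero zero    = z≤n
  lower≤upper-zero (suc k) = ℕP.m≤n⇒m≤1+n (ℕP.+-mono-≤ (FinP.toℕ≤n k) (FinP.toℕ≤n k))

  -- Intersection of intervals expressed by indices alone, so that adjacency in `G` is decidable.
  Meet : Rel (Fin (suc N)) 0ℓ
  Meet a b = a ≡ zero ⊎ b ≡ zero ⊎ a ≡ b

  meet? : ∀ a b → Dec (Meet a b)
  meet? a b = (a FinP.≟ zero) ⊎-dec ((b FinP.≟ zero) ⊎-dec (a FinP.≟ b))

  meet-sym : ∀ {a b} → Meet a b → Meet b a
  meet-sym (inj₁ a≡0)        = inj₂ (inj₁ a≡0)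
  meet-sym (inj₂ (inj₁ b≡0)) = inj₁ b≡0
  meet-sym (inj₂ (inj₂ a≡b)) = inj₂ (inj₂ (sym a≡b))

  meet⇒common : ∀ {a b} → Meet a b →
    ∃[ m ] ((lower a ℕ.≤ m × m ℕ.≤ upper a) × (lower b ℕ.≤ m × m ℕ.≤ upper b))
  meet⇒common {b = b} (inj₁ refl) =
    lower b , (z≤n , lower≤upper-zero b) , (ℕP.≤-refl , ℕP.<⇒≤ (lower<upper b))
  meet⇒common {a} (inj₂ (inj₁ refl)) =
    lower a , (ℕP.≤-refl , ℕP.<⇒≤ (lower<upper a)) , (z≤n , lower≤upper-zero a)
  meet⇒common {a} (inj₂ (inj₂ refl)) =
    lower a , (ℕP.≤-refl , ℕP.<⇒≤ (lower<upper a)) , (ℕP.≤-refl , ℕP.<⇒≤ (lower<upper a))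

  upper<lower : ∀ {k l : Fin N} → toℕ k ℕ.< toℕ l → upper (suc k) ℕ.< lower (suc l)
  upper<lower {k} {l} k<l = ℕP.≤-trans (ℕP.≤-reflexive (cong suc (sym (ℕP.+-suc (toℕ k) (toℕ k)))))
    (ℕP.+-mono-≤ k<l k<l)

  ¬meet⇒separated : ∀ {a b} → ¬ Meet a b → upper a ℕ.< lower b ⊎ upper b ℕ.< lower a
  ¬meet⇒separated {zero}          ¬m = ⊥-elim (¬m (inj₁ refl))
  ¬meet⇒separated {suc k} {zero}  ¬m = ⊥-elim (¬m (inj₂ (inj₁ refl)))
  ¬meet⇒separated {suc k} {suc l} ¬m with ℕP.<-cmp (toℕ k) (toℕ l)
  ... | tri< k<l _ _ = inj₁ (upper<lower k<l)
  ... | tri≈ _ k≡l _ = ⊥-elim (¬m (inj₂ (inj₂ (cong suc (FinP.toℕ-injective k≡l)))))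
  ... | tri> _ _ l<k = inj₂ (upper<lower l<k)

  xOf yOf : Fin (suc N ℕ.* suc N) → Fin (suc N)
  xOf i = proj₁ (remQuot {suc N} (suc N) i)
  yOf i = proj₂ (remQuot {suc N} (suc N) i)

  -- A vertex is a pair of intervals, hence a rectangle: two indices `zero` give the square `U`,
  -- exactly one gives a row or a column, none gives a cell. `Meet` is reflexive, whence the
  -- condition `i ≢ j`.
  G : Graph
  G = record
    { order       = suc N ℕ.* suc N
    ; Adj         = λ i j → i ≢ j × Meet (xOf i) (xOf j) × Meet (yOf i) (yOf j)
    ; adj?        = λ i j → ¬? (i FinP.≟ j) ×-dec (meet? (xOf i) (xOf j) ×-dec meet? (yOf i) (yOf j))
    ; symmetric   = λ (i≢j , mx , my) → (λ j≡i → i≢j (sym j≡i)) , meet-sym mx , meet-sym my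
    ; irreflexive = λ i (i≢i , _) → i≢i refl
    }

  bounds : ∀ a → fromℕ (lower a) ℚ.< fromℕ (upper a)
  bounds a = fromℕ-mono-< (lower<upper a)

  DIR-CONV-G : ∀ k → (suc (suc k) DIR-CONV) G
  DIR-CONV-G k = directions (suc k) , rectangle , (λ i → box∈𝒫 (bounds (xOf i)) (bounds (yOf i))) , λ i j i≢j →
    mk⇔ (λ (_ , mx , my) → common i j (meet⇒common mx) (meet⇒common my))
        (λ meets → i≢j , meetsX i j meets , meetsY i j meets)
    where
    rectangle : Fin (suc N ℕ.* suc N) → Polygon
    rectangle i = box (bounds (xOf i)) (bounds (yOf i))

    common : ∀ i j →
      ∃[ m ] ((lower (xOf i) ℕ.≤ m × m ℕ.≤ upper (xOf i)) × (lower (xOf j) ℕ.≤ m × m ℕ.≤ upper (xOf j))) →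
      ∃[ m ] ((lower (yOf i) ℕ.≤ m × m ℕ.≤ upper (yOf i)) × (lower (yOf j) ℕ.≤ m × m ℕ.≤ upper (yOf j))) →
      polygon (rectangle i) ≬ polygon (rectangle j)
    common i j (m , (p , q) , (p′ , q′)) (n , (r , s) , (r′ , s′)) = (fromℚ (fromℕ m) , fromℚ (fromℕ n)) ,
      ∈-box (bounds (xOf i)) (bounds (yOf i)) (fromℕ-mono-≤ p) (fromℕ-mono-≤ q) (fromℕ-mono-≤ r) (fromℕ-mono-≤ s) ,
      ∈-box (bounds (xOf j)) (bounds (yOf j)) (fromℕ-mono-≤ p′) (fromℕ-mono-≤ q′) (fromℕ-mono-≤ r′) (fromℕ-mono-≤ s′)

    swap : ∀ {i j} → polygon (rectangle i) ≬ polygon (rectangle j) → polygon (rectangle j) ≬ polygon (rectangle i)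
    swap (p , p∈ , p∈′) = p , p∈′ , p∈

    meetsX : ∀ i j → polygon (rectangle i) ≬ polygon (rectangle j) → Meet (xOf i) (xOf j)
    meetsX i j meets with meet? (xOf i) (xOf j)
    ... | yes m = m
    ... | no ¬m with ¬meet⇒separated ¬m
    ...   | inj₁ h = ⊥-elim (separated-x (bounds (xOf i)) (bounds (yOf i)) (bounds (xOf j)) (bounds (yOf j))
                       (fromℕ-mono-< h) meets)
    ...   | inj₂ h = ⊥-elim (separated-x (bounds (xOf j)) (bounds (yOf j)) (bounds (xOf i)) (bounds (yOf i))
                       (fromℕ-mono-< h) (swap {i} {j} meets))

    meetsY : ∀ i j → polygon (rectangle i) ≬ polygon (rectangle j) → Meet (yOf i) (yOf j)
    meetsY i j meets with meet? (yOf i) (yOf j)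
    ... | yes m = m
    ... | no ¬m with ¬meet⇒separated ¬m
    ...   | inj₁ h = ⊥-elim (separated-y (bounds (xOf i)) (bounds (yOf i)) (bounds (xOf j)) (bounds (yOf j))
                       (fromℕ-mono-< h) meets)
    ...   | inj₂ h = ⊥-elim (separated-y (bounds (xOf j)) (bounds (yOf j)) (bounds (xOf i)) (bounds (yOf i))
                       (fromℕ-mono-< h) (swap {i} {j} meets))

  -- All vertices except `U`. `centre b l` is the column (for `b = zero`) or the row through the
  -- cells whose label `b` is `l`: it is the centre of a star of links in the sense of `no-abab`.
  data Member : Set where
    centre : Fin 2 → Fin N → Member
    cell   : Fin (N ℕ.* N) → Member

  label : Fin 2 → Fin (N ℕ.* N) → Fin N
  label zero    x = proj₁ (remQuot {N} N x)
  label (suc _) x = proj₂ (remQuot {N} N x)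

  coordinate : Fin 2 → Member → Fin (suc N)
  coordinate zero          (centre zero l)          = suc l
  coordinate zero          (centre (suc zero) l)    = zero
  coordinate (suc zero)    (centre zero l)          = zero
  coordinate (suc zero)    (centre (suc zero) l)    = suc l
  coordinate b             (cell x)                 = suc (label b x)

  labels-separate : ∀ x y → (∀ b → label b x ≡ label b y) → x ≡ y
  labels-separate x y eq = trans (sym (FinP.combine-remQuot {N} N x))
    (trans (cong₂ combine (eq zero) (eq (suc zero))) (FinP.combine-remQuot {N} N y))

  -- Finitely many double negations merge into one, so all comparisons of reals that the counting
  -- needs can be decided at once.
  ¬¬-sequence : ∀ {n} {P : Fin n → Set} → (∀ i → ¬ ¬ P i) → ¬ ¬ (∀ i → P i)
  ¬¬-sequence = FinP.sequence (RawMonad.rawApplicative ¬¬-Monad)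

  -- Consequences of a representation of the grid graph by segments

  module Representation (s : Fin (suc N ℕ.* suc N) → Segment)
    (represents : IsIntersectionGraphOf G (λ i → segment (s i))) where

    at : Fin (suc N) → Fin (suc N) → Segment
    at a b = s (combine a b)

    meets : ∀ {a b a′ b′} → ¬ (a ≡ a′ × b ≡ b′) → Meet a a′ → Meet b b′ → segment (at a b) ≬ segment (at a′ b′)
    meets {a} {b} {a′} {b′} differ ma mb = Equivalence.to (represents (combine a b) (combine a′ b′) ≢′)
      (≢′ , subst₂ Meet (sym (cong proj₁ (FinP.remQuot-combine a b))) (sym (cong proj₁ (FinP.remQuot-combine a′ b′))) ma
          , subst₂ Meet (sym (cong proj₂ (FinP.remQuot-combine a b))) (sym (cong proj₂ (FinP.remQuot-combine a′ b′))) mb)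
      where
      ≢′ : combine a b ≢ combine a′ b′
      ≢′ eq = differ (FinP.combine-injective a b a′ b′ eq)

    meet-of : ∀ {a b a′ b′} → ¬ (a ≡ a′ × b ≡ b′) → segment (at a b) ≬ segment (at a′ b′) → Meet a a′ × Meet b b′
    meet-of {a} {b} {a′} {b′} differ m =
      let _ , ma , mb = Equivalence.from (represents (combine a b) (combine a′ b′)
                          (λ eq → differ (FinP.combine-injective a b a′ b′ eq))) m
      in subst₂ Meet (cong proj₁ (FinP.remQuot-combine a b)) (cong proj₁ (FinP.remQuot-combine a′ b′)) ma
       , subst₂ Meet (cong proj₂ (FinP.remQuot-combine a b)) (cong proj₂ (FinP.remQuot-combine a′ b′)) mb

    U : Segment
    U = at zero zero

    S : Member → Segment
    S m = at (coordinate zero m) (coordinate (suc zero) m)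

    stabs : ∀ m → segment U ≬ segment (S m)
    stabs m = meets (nontrivial m) (inj₁ refl) (inj₁ refl)
      where
      nontrivial : ∀ m → ¬ (zero ≡ coordinate zero m × zero ≡ coordinate (suc zero) m)
      nontrivial (centre zero l)       (() , _)
      nontrivial (centre (suc zero) l) (_ , ())
      nontrivial (cell x)              (() , _)

    open Stabbed U using (ordinate; module Family)
    open Family S stabs

    -- Different small intervals in direction `b` are disjoint. This supplies every disjointness
    -- that `no-abab` asks for, because the members of two stars differ in the label that defines
    -- the stars.
    distinct-coordinate : ∀ b {m m′ l l′} → coordinate b m ≡ suc l → coordinate b m′ ≡ suc l′ → l ≢ l′ → ¬ (m ⋈ m′)
    distinct-coordinate b {m} {m′} {l} {l′} eq eq′ l≢l′ meet = ¬meet (both b)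
      where
      ≢b : ∀ b → coordinate b m ≡ suc l → coordinate b m′ ≡ suc l′ →
           ¬ (coordinate zero m ≡ coordinate zero m′ × coordinate (suc zero) m ≡ coordinate (suc zero) m′)
      ≢b zero       e e′ (p , _) = l≢l′ (FinP.suc-injective (trans (sym e) (trans p e′)))
      ≢b (suc zero) e e′ (_ , p) = l≢l′ (FinP.suc-injective (trans (sym e) (trans p e′)))

      both : ∀ b → Meet (coordinate b m) (coordinate b m′)
      both zero       = proj₁ (meet-of (≢b b eq eq′) meet)
      both (suc zero) = proj₂ (meet-of (≢b b eq eq′) meet)

      ¬meet : Meet (coordinate b m) (coordinate b m′) → ⊥
      ¬meet mt with subst₂ Meet eq eq′ mt
      ... | inj₁ ()
      ... | inj₂ (inj₁ ())
      ... | inj₂ (inj₂ p) = l≢l′ (FinP.suc-injective p)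

    coordinate-centre : ∀ b l → coordinate b (centre b l) ≡ suc l
    coordinate-centre zero       l = refl
    coordinate-centre (suc zero) l = refl

    coordinate-cell : ∀ b x → coordinate b (cell x) ≡ suc (label b x)
    coordinate-cell zero       x = refl
    coordinate-cell (suc zero) x = refl

    joined : ∀ b x → centre b (label b x) ⋈ cell x
    joined zero       x = meets {suc (label zero x)} {zero} {suc (label zero x)} {suc (label (suc zero) x)} (λ { (_ , ()) }) (inj₂ (inj₂ refl)) (inj₁ refl)
    joined (suc zero) x = meets {zero} {suc (label (suc zero) x)} {suc (label zero x)} {suc (label (suc zero) x)} (λ { (() , _) }) (inj₁ refl) (inj₂ (inj₂ refl))

    _⊏_ : Rel (Fin (N ℕ.* N)) 0ℓ
    x ⊏ y = cell x ≺ cell y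

    High : Fin 2 → Fin (N ℕ.* N) → Set
    High b x = 0ℝ ≤ ordinate (proj₁ (joined b x))

    -- The two hypotheses contain all comparisons of reals, so that order, sides and classes become
    -- decidable data for `Counting`.
    module Decided (_⊏?_ : ∀ x y → Dec (x ⊏ y)) (high? : ∀ b x → Dec (High b x)) where

      different-label : ∀ {x y} → x ≢ y → ∃[ b ] label b x ≢ label b y
      different-label {x} {y} x≢y with label zero x FinP.≟ label zero y | label (suc zero) x FinP.≟ label (suc zero) y
      ... | no p≢  | _     = zero , p≢
      ... | yes _ | no q≢  = suc zero , q≢
      ... | yes p | yes q = ⊥-elim (x≢y (labels-separate x y λ { zero → p ; (suc zero) → q }))

      disjoint-cells : ∀ {x y} b → label b x ≢ label b y → ¬ (cell x ⋈ cell y)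
      disjoint-cells {x} {y} b = distinct-coordinate b (coordinate-cell b x) (coordinate-cell b y)

      trichotomy : ∀ {x y} → Dec (x ≡ y) → Dec (x ⊏ y) → Dec (y ⊏ x) → Tri (x ⊏ y) (x ≡ y) (y ⊏ x)
      trichotomy {x} (yes refl) _         _         = tri≈ (≺-irrefl {cell x}) refl (≺-irrefl {cell x})
      trichotomy {x} {y} (no x≢y) (yes x⊏y) _       = tri< x⊏y x≢y (≺-asym {cell x} {cell y} x⊏y)
      trichotomy (no x≢y) (no x⊏̸y)  (yes y⊏x) = tri> x⊏̸y x≢y y⊏x
      trichotomy {x} {y} (no x≢y) (no x⊏̸y)  (no y⊏̸x)  = ⊥-elim (separated {cell x} {cell y}
        (uncurry disjoint-cells (different-label x≢y)) x⊏̸y y⊏̸x)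

      isSTO : IsStrictTotalOrder _≡_ _⊏_
      isSTO = record
        { isStrictPartialOrder = record
          { isEquivalence = isEquivalence
          ; irrefl        = λ { {x} refl → ≺-irrefl {cell x} }
          ; trans         = λ {x} {y} {z} → ≺-trans {cell x} {cell y} {cell z}
          ; <-resp-≈      = (λ { refl h → h }) , (λ { refl h → h })
          }
        ; compare = λ x y → trichotomy (x FinP.≟ y) (x ⊏? y) (y ⊏? x)
        }

      side : Fin 2 → Fin (N ℕ.* N) → Fin 2
      side b x = sign (high? b x)

      link : ∀ b x → Linked (side b x) (centre b (label b x)) (cell x)
      link b x = ⋈⇒Linked {centre b (label b x)} {cell x} (joined b x) (high? b x)

      -- Records the sides of `U` on which the cell is linked to its column and to its row, so that
      -- within a class the links to be compared lie on one side.
      class : Fin (N ℕ.* N) → Fin (2 ℕ.* 2)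
      class x = combine (side zero x) (side (suc zero) x)

      class⇒side : ∀ b {x y} → class x ≡ class y → side b x ≡ side b y
      class⇒side zero       {x} {y} eq = FinP.combine-injectiveˡ (side zero x) _ (side zero y) _ eq
      class⇒side (suc zero) {x} {y} eq = FinP.combine-injectiveʳ (side zero x) _ (side zero y) _ eq

      -- The cells `w` and `y` are linked to the centre `c`, and `x` and `z` to `d`. Equal classes
      -- move all four links to the same side, where `no-abab` applies.
      crossing-labels : ∀ b w x y z → w ⊏ x → x ⊏ y → y ⊏ z →
        class x ≡ class w → class y ≡ class w → class z ≡ class w →
        label b w ≡ label b y → label b x ≡ label b z → label b w ≢ label b x → ⊥
      crossing-labels b w x y z w⊏x x⊏y y⊏z cx cy cz w≡y x≡z w≢x =
        no-abab (side b w) {cell w} {cell x} {cell y} {cell z} {c} {d}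
          (link b w)
          (subst₂ (λ s l → Linked s (centre b l) (cell y)) (class⇒side b cy) (sym w≡y) (link b y))
          (subst (λ s → Linked s d (cell x)) (class⇒side b cx) (link b x))
          (subst₂ (λ s l → Linked s (centre b l) (cell z)) (class⇒side b cz) (sym x≡z) (link b z))
          (disjoint-cells b w≢x) (disjoint-cells b w≢z) (apart {cell w} {d} (coordinate-cell b w) (coordinate-centre b (label b x)) w≢x)
          (disjoint-cells b y≢x) (disjoint-cells b y≢z) (apart {cell y} {d} (coordinate-cell b y) (coordinate-centre b (label b x)) y≢x)
          (apart {c} {cell x} (coordinate-centre b (label b w)) (coordinate-cell b x) w≢x)
          (apart {c} {cell z} (coordinate-centre b (label b w)) (coordinate-cell b z) w≢z)
          (apart {c} {d} (coordinate-centre b (label b w)) (coordinate-centre b (label b x)) w≢x)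
          w⊏x x⊏y y⊏z
        where
        c d : Member
        c = centre b (label b w)
        d = centre b (label b x)
        apart : ∀ {m m′ l l′} → coordinate b m ≡ suc l → coordinate b m′ ≡ suc l′ → l ≢ l′ → ¬ (m ⋈ m′)
        apart {m} {m′} = distinct-coordinate b {m} {m′}
        w≢z : label b w ≢ label b z
        w≢z eq = w≢x (trans eq (sym x≡z))
        y≢x : label b y ≢ label b x
        y≢x eq = w≢x (trans w≡y eq)
        y≢z : label b y ≢ label b z
        y≢z eq = w≢z (trans w≡y eq)

      open Counting isSTO class label labels-separate crossing-labels public using (bound)

  -- Four classes, two label functions, `N` labels and two ends make `16 * N` tokens. The double
  -- negation stems from deciding the comparisons.
  SEG⇒bound : SEG G → ¬ ¬ (N ℕ.* N ℕ.≤ 4 ℕ.* (2 ℕ.* (N ℕ.* 2)))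
  SEG⇒bound (s , represents) k =
    ¬¬-sequence (λ x → ¬¬-sequence λ y → ¬¬-excluded-middle) λ _⊏?_ →
    ¬¬-sequence (λ b → ¬¬-sequence λ x → ¬¬-excluded-middle) λ high? →
    k (Decided.bound _⊏?_ high?)
    where open Representation s represents

theorem2 : (k : ℕ) → k ≥ 2 → ∃[ G ] ((k DIR-CONV) G × ¬ SEG G)
-- `17 * 17 = 289` exceeds `16 * 17 = 272`; the strict inequality is checked by evaluation as
-- `273 ≤ 289`.
theorem2 (suc (suc k)) (s≤s (s≤s z≤n)) = G , DIR-CONV-G k , λ seg → SEG⇒bound seg (ℕP.<⇒≱ (ℕP.≤ᵇ⇒≤ 273 289 _))
  where open Grid 17
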